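{- Let $n\to\infty$ and let $d=d(n)$ and $\ell=\ell(n)$ be integers with $d\mid n$, $d=o(n/\log n)$ and $\ell<d/2$. Set $k=n/d$. Pick a uniformly random $d$-linear form $f:(\mathbb{F}_2^k)^d\to\mathbb{F}_2$, viewed as a function on $\mathbb{F}_2^{n}=(\mathbb{F}_2^k)^d$. Then with probability $1-o(1)$, $f$ has the following property: for every polynomial $P(X_1,\dots,X_n)\in\mathbb{F}_2[X_1,\dots,X_n]$ of degree at most $\ell$, $$\mathrm{Corr}(f,P)<2^{ -(1-o(1))n/d}.$$ (Here the $o(1)$ terms tend to $0$ as $n\to\infty$.)
   Context: A $d$-linear form $f:(\mathbb{F}_2^k)^d\to\mathbb{F}_2$ is a map that is $\mathbb{F}_2$-linear in each of its $d$ arguments; equivalently $f(x_1,\dots,x_d)=\sum_{(i_1,\dots,i_d)\in[k]^d}T(i_1,\dots,i_d)\,x_{1,i_1}\cdots x_{d,i_d}$ for a tensor $T:[k]^d\to\mathbb{F}_2$; a uniformly random $d$-linear form means all entries of $T$ are independent uniform bits. For $g:\mathbb{F}_2^n\to\mathbb{F}_2$, $\mathrm{bias}(g)=\left|\mathbb{E}_{x\in\mathbb{F}_2^n}(-1)^{g(x)}\right|$, and $\mathrm{Corr}(f,g)=\mathrm{bias}(f-g)$. -}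

module Defs where

open import Data.Bool using (Bool; true; false; _∧_; _xor_; if_then_else_)
open import Data.Nat as ℕ using (ℕ; zero; suc; _+_; _*_; _^_; _≤_; _<_)
open import Data.Nat.Divisibility using (_∣_; quotient)
open import Data.Nat.Logarithm using (⌊log₂_⌋)
open import Data.Integer as ℤ using (ℤ; +_; -[1+_])
open import Data.Fin using (Fin; zero; suc; combine)
open import Data.List using (List; []; _∷_; map; concatMap; foldr; filter; length; allFin)
open import Data.List.Relation.Unary.All using (All)
open import Data.Vec.Functional as VF using ()
open import Data.Rational as ℚ using (ℚ; 0ℚ; 1ℚ; ↥_; ↧ₙ_)
open import Data.Product using (Σ; ∃; _×_)
open import Relation.Binary.PropositionalEquality using (_≡_)
open import Relation.Nullary.Decidable using (does)
open import Data.Bool.Properties using (_≟_)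

allFunsTo : {A : Set} → (m : ℕ) → List A → List (Fin m → A)
allFunsTo zero    xs = (λ ()) ∷ []
allFunsTo (suc m) xs = concatMap (λ a → map (λ f → a VF.∷ f) (allFunsTo m xs)) xs

-- F₂ = Bool (false = 0, true = 1, xor = +, ∧ = ·)
allBools : List Bool
allBools = false ∷ true ∷ []

allVecs : (m : ℕ) → List (Fin m → Bool)
allVecs m = allFunsTo m allBools

allIdx : (d k : ℕ) → List (Fin d → Fin k)
allIdx d k = allFunsTo d (allFin k)

xorSum : List Bool → Bool
xorSum = foldr _xor_ false

andFin : (m : ℕ) → (Fin m → Bool) → Bool
andFin zero    b = true
andFin (suc m) b = b zero ∧ andFin m (λ i → b (suc i))

sumFin : (m : ℕ) → (Fin m → ℕ) → ℕ
sumFin zero    e = 0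
sumFin (suc m) e = e zero + sumFin m (λ i → e (suc i))

Tensor : ℕ → ℕ → Set
Tensor zero    k = Bool
Tensor (suc d) k = Fin k → Tensor d k

allTensors : (d k : ℕ) → List (Tensor d k)
allTensors zero    k = allBools
allTensors (suc d) k = allFunsTo k (allTensors d k)

entry : {d k : ℕ} → Tensor d k → (Fin d → Fin k) → Bool
entry {zero}  T idx = T
entry {suc d} T idx = entry (T (idx zero)) (λ j → idx (suc j))

multilinearForm : {d k : ℕ} → Tensor d k → (Fin d → Fin k → Bool) → Bool
multilinearForm {d} {k} T x =
  xorSum (map (λ idx → entry T idx ∧ andFin d (λ j → x j (idx j))) (allIdx d k))

-- the same form viewed as a function on F₂^(d·k) = (F₂^k)^d,
-- coordinate (j , i) of block j being  combine j i = j·k + i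
formOnFlat : {d k : ℕ} → Tensor d k → (Fin (d * k) → Bool) → Bool
formOnFlat T x = multilinearForm T (λ j i → x (combine j i))

-- Polynomials in F₂[X₁,…,X_N]: a finite F₂-sum of monomials,
-- a monomial being given by its exponent vector e : Fin N → ℕ.

Monomial : ℕ → Set
Monomial N = Fin N → ℕ

Poly : ℕ → Set
Poly N = List (Monomial N)

powB : Bool → ℕ → Bool
powB b zero    = true
powB b (suc e) = b ∧ powB b e

evalMono : {N : ℕ} → Monomial N → (Fin N → Bool) → Bool
evalMono {N} e x = andFin N (λ i → powB (x i) (e i))

evalPoly : {N : ℕ} → Poly N → (Fin N → Bool) → Bool
evalPoly P x = xorSum (map (λ e → evalMono e x) P)

monoDeg : {N : ℕ} → Monomial N → ℕ
monoDeg {N} e = sumFin N e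

DegAtMost : {N : ℕ} → ℕ → Poly N → Set
DegAtMost ℓ P = All (λ e → monoDeg e ≤ ℓ) P

sign : Bool → ℤ
sign false = + 1
sign true  = -[1+ 0 ]

signSum : (N : ℕ) → ((Fin N → Bool) → Bool) → ℤ
signSum N g = foldr ℤ._+_ (+ 0) (map (λ x → sign (g x)) (allVecs N))

-- 2^N · bias(g) = |Σ_x (-1)^{g(x)}|  (a natural number)
biasNum : (N : ℕ) → ((Fin N → Bool) → Bool) → ℕ
biasNum N g = ℤ.∣ signSum N g ∣

-- 2^N · Corr(f,g) = 2^N · bias(f - g)
corrNum : (N : ℕ) → ((Fin N → Bool) → Bool) → ((Fin N → Bool) → Bool) → ℕ
corrNum N f g = biasNum N (λ x → f x xor g x)

-- CorrBelow N k ε f g  :⇔  Corr(f,g) < 2^{-(1-ε)k}.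
-- Writing Corr = S/2^N and ε = p/q (q > 0) this is, after raising to the
-- q-th power, (S/2^N)^q < 2^{(p-q)k}, i.e.
--   p ≥ 0 :  S^q · 2^{qk}          < 2^{Nq} · 2^{pk}
--   p < 0 :  S^q · 2^{qk} · 2^{|p|k} < 2^{Nq}
CorrBelow : (N k : ℕ) → ℚ → ((Fin N → Bool) → Bool) → ((Fin N → Bool) → Bool) → Set
CorrBelow N k ε f g with ↥ ε
... | + p      = (corrNum N f g ^ q) * 2 ^ (q * k) < 2 ^ (N * q) * 2 ^ (p * k)
  where q = ↧ₙ ε
... | -[1+ m ] = (corrNum N f g ^ q) * 2 ^ (q * k) * 2 ^ (suc m * k) < 2 ^ (N * q)
  where q = ↧ₙ ε

toℚ : ℕ → ℚ
toℚ m = + m ℚ./ 1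

TendsToZero : (ℕ → ℚ) → Set
TendsToZero a = ∀ (δ : ℚ) → 0ℚ ℚ.< δ → Σ ℕ λ N₀ → ∀ n → N₀ ≤ n → ℚ.∣ a n ∣ ℚ.< δ

-- d(n) = o(n / log n)   (log to base 2; floor is immaterial asymptotically)
LittleONOverLog : (ℕ → ℕ) → Set
LittleONOverLog d = ∀ (δ : ℚ) → 0ℚ ℚ.< δ → Σ ℕ λ N₀ → ∀ n → N₀ ≤ n →
  toℚ (d n * ⌊log₂ n ⌋) ℚ.< δ ℚ.* toℚ n

countTensors : (d k : ℕ) → (Tensor d k → Bool) → ℕ
countTensors d k S = length (filter (λ T → S T ≟ true) (allTensors d k))

ProbTendsToOne : (d k : ℕ → ℕ) → ((n : ℕ) → Tensor (d n) (k n) → Bool) → Set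
ProbTendsToOne d k S = ∀ (δ : ℚ) → 0ℚ ℚ.< δ → Σ ℕ λ N₀ → ∀ n → N₀ ≤ n →
  (1ℚ ℚ.- δ) ℚ.* toℚ (length (allTensors (d n) (k n))) ℚ.≤ toℚ (countTensors (d n) (k n) (S n))

{-# OPTIONS --safe #-}
-- Let m = d - 1. The t-th moment over T of the correlation sum of f_T with a fixed P expands over
-- t-tuples of points; averaging over T keeps only the tuples whose rank-one tensors sum to zero, and
-- bounds the moment by the moment for P = 0. Splitting off one tensor factor, those tuples are counted
-- with weight 2^(-k rank), where the rank is that of t random rank-one tensors of order m. A subspace V
-- with fewer than 2^(s^m) elements contains a random rank-one tensor with probability at most
-- m 2^(s - k): fewer than s linearly independent a can have a fibre {w : a ⊗ w ∈ V} of size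
-- ≥ 2^(s^(m-1)), and the other fibres are handled by induction. So the t-th moment is at most
-- (d 2^(s - k))^t relative to the trivial bound for t ≤ s^m. With s = 4 ⌈√k⌉ and t = s^m there are at
-- most 2^(2t) polynomial functions of degree ≤ ℓ ≤ m/2, and Markov's inequality with the union bound finish.
-- For d = 1 we have t = 1, which is not even; there P is constant and orthogonality of characters
-- gives the first absolute moment.
module Submission where

open import Defs
open import Data.Bool using (Bool; true; false; _∧_; _∨_; _xor_; not)
open import Data.Bool.Properties as Boolₚ using (xor-assoc; xor-comm; xor-identityˡ; xor-identityʳ; xor-same)
open import Data.Nat using (ℕ; zero; suc; _+_; _*_; _^_; _≤_; _<_; _≤ᵇ_; z≤n; s≤s; NonZero; >-nonZero; >-nonZero⁻¹)
open import Data.Nat.Properties as ℕₚ using (module ≤-Reasoning)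
open import Data.Nat.Divisibility using (_∣_; quotient; ∣⇒≤)
open import Data.Nat.Logarithm using (⌊log₂_⌋; ⌊log₂⌋-mono-≤; ⌊log₂[2^n]⌋≡n)
open import Data.Rational as ℚ using (ℚ; 0ℚ; 1ℚ; ↥_; ↧_; ↧ₙ_)
import Data.Rational.Properties as ℚₚ
import Data.Rational.Unnormalised as ℚᵘ
import Data.Rational.Unnormalised.Properties as ℚᵘₚ
open import Data.Integer as ℤ using (ℤ)
open import Data.Integer.Properties as ℤₚ using ()
open import Data.Fin using (Fin; zero; suc; combine; _↑ˡ_; _↑ʳ_)
open import Data.List using (List; []; _∷_; _++_; map; concatMap; foldr; length; filter; allFin; tabulate)
open import Data.Vec.Functional as VF using ()
open import Data.Product using (Σ; ∃; _×_; _,_; proj₁; proj₂)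
open import Data.Empty using (⊥)
open import Relation.Nullary using (yes; no)
open import Data.Sum using (_⊎_; inj₁; inj₂)
open import Function using (id; _∘_; case_of_)
open import Function.Bundles using (Equivalence)
open import Algebra.Bundles using (CommutativeRing)
open import Algebra.Structures using (IsCommutativeSemiring; IsAbelianGroup)
import Algebra.Construct.Pointwise as Pointwise
import Data.Vec.Functional.Properties as VFₚ
open import Data.Nat.Tactic.RingSolver using () renaming (solve-∀ to ℕ-solve-∀)
open import Data.List.Relation.Unary.All using ([]; _∷_)
open import Data.Integer.Tactic.RingSolver using () renaming (solve-∀ to ℤ-solve-∀)
open import Relation.Binary.PropositionalEquality
  using (_≡_; refl; sym; trans; cong; cong₂; subst; subst₂; isEquivalence; module ≡-Reasoning)

-- The obstacle is the number of competitors. Degree at most ℓ allows 2^M functions, with M bounded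
-- by (2k)^ℓ 2^d, so the union bound requires failure probabilities near 2^(-M), hence moments whose
-- order t is comparable with M. Such a t may far exceed k, and the spans met while counting
-- zero-sum tuples may be very large; the count survives because rank-one tensors stay rare in every
-- subspace of dimension below s^m. Two demands on s pull apart: s^m has to reach M, yet s has to be
-- o(k), because every point of a tuple costs a factor 2^s. Since 2ℓ ≤ m, a value of order √k serves
-- both: (√k)^m is at least k^ℓ. The factor 4 in s absorbs what is left of the bound on M and makes
-- t even as soon as m ≥ 1. Functions and tensors are compared pointwise, so sums over enumerations
-- are manipulated through functions that respect this equality.

module Summation {C : Set} {_∔_ _∙_ : C → C → C} {0# 1# : C}
                 (isCommutativeSemiring : IsCommutativeSemiring _≡_ _∔_ _∙_ 0# 1#) where
  open IsCommutativeSemiring isCommutativeSemiring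
    using (+-assoc; +-comm; +-identityˡ; +-identityʳ; *-comm; distribˡ; zeroʳ)
  open ≡-Reasoning

  ∑ : {A : Set} → List A → (A → C) → C
  ∑ xs F = foldr _∔_ 0# (map F xs)

  ∏ : (n : ℕ) → (Fin n → C) → C
  ∏ zero    h = 1#
  ∏ (suc n) h = h zero ∙ ∏ n (h ∘ suc)

  medial : ∀ a b c d → (a ∔ b) ∔ (c ∔ d) ≡ (a ∔ c) ∔ (b ∔ d)
  medial a b c d = begin
    (a ∔ b) ∔ (c ∔ d)  ≡⟨ +-assoc a b _ ⟩
    a ∔ (b ∔ (c ∔ d))  ≡⟨ cong (a ∔_) (sym (+-assoc b c d)) ⟩
    a ∔ ((b ∔ c) ∔ d)  ≡⟨ cong (λ z → a ∔ (z ∔ d)) (+-comm b c) ⟩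
    a ∔ ((c ∔ b) ∔ d)  ≡⟨ cong (a ∔_) (+-assoc c b d) ⟩
    a ∔ (c ∔ (b ∔ d))  ≡⟨ sym (+-assoc a c _) ⟩
    (a ∔ c) ∔ (b ∔ d)  ∎

  ∑-cong : {A : Set} (xs : List A) {F G : A → C} → (∀ x → F x ≡ G x) → ∑ xs F ≡ ∑ xs G
  ∑-cong []       eq = refl
  ∑-cong (x ∷ xs) eq = cong₂ _∔_ (eq x) (∑-cong xs eq)

  ∑-zero : {A : Set} (xs : List A) → ∑ xs (λ _ → 0#) ≡ 0#
  ∑-zero []       = refl
  ∑-zero (x ∷ xs) = trans (+-identityˡ _) (∑-zero xs)

  ∑-distrib-+ : {A : Set} (xs : List A) (F G : A → C) → ∑ xs (λ x → F x ∔ G x) ≡ ∑ xs F ∔ ∑ xs G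
  ∑-distrib-+ []       F G = sym (+-identityˡ 0#)
  ∑-distrib-+ (x ∷ xs) F G =
    trans (cong ((F x ∔ G x) ∔_) (∑-distrib-+ xs F G)) (medial (F x) (G x) (∑ xs F) (∑ xs G))

  *-distribˡ-∑ : {A : Set} (xs : List A) (c : C) (F : A → C) → c ∙ ∑ xs F ≡ ∑ xs (λ x → c ∙ F x)
  *-distribˡ-∑ []       c F = zeroʳ c
  *-distribˡ-∑ (x ∷ xs) c F =
    trans (distribˡ c (F x) (∑ xs F)) (cong ((c ∙ F x) ∔_) (*-distribˡ-∑ xs c F))

  *-distribʳ-∑ : {A : Set} (xs : List A) (c : C) (F : A → C) → ∑ xs F ∙ c ≡ ∑ xs (λ x → F x ∙ c)
  *-distribʳ-∑ xs c F =
    trans (*-comm _ c) (trans (*-distribˡ-∑ xs c F) (∑-cong xs (λ x → *-comm c (F x))))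

  ∑-swap : {A B : Set} (xs : List A) (ys : List B) (F : A → B → C) →
           ∑ xs (λ x → ∑ ys (F x)) ≡ ∑ ys (λ y → ∑ xs (λ x → F x y))
  ∑-swap []       ys F = sym (∑-zero ys)
  ∑-swap (x ∷ xs) ys F =
    trans (cong (∑ ys (F x) ∔_) (∑-swap xs ys F)) (sym (∑-distrib-+ ys (F x) _))

  ∑-++ : {A : Set} (xs ys : List A) (F : A → C) → ∑ (xs ++ ys) F ≡ ∑ xs F ∔ ∑ ys F
  ∑-++ []       ys F = sym (+-identityˡ _)
  ∑-++ (x ∷ xs) ys F = trans (cong (F x ∔_) (∑-++ xs ys F)) (sym (+-assoc _ _ _))

  ∑-map : {A B : Set} (f : A → B) (xs : List A) (F : B → C) → ∑ (map f xs) F ≡ ∑ xs (F ∘ f)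
  ∑-map f []       F = refl
  ∑-map f (x ∷ xs) F = cong (F (f x) ∔_) (∑-map f xs F)

  ∑-concatMap : {A B : Set} (f : A → List B) (xs : List A) (F : B → C) →
                ∑ (concatMap f xs) F ≡ ∑ xs (λ x → ∑ (f x) F)
  ∑-concatMap f []       F = refl
  ∑-concatMap f (x ∷ xs) F =
    trans (∑-++ (f x) (concatMap f xs) F) (cong (∑ (f x) F ∔_) (∑-concatMap f xs F))

  ∑-allFunsTo-suc : {A : Set} (n : ℕ) (xs : List A) (F : (Fin (suc n) → A) → C) →
    ∑ (allFunsTo (suc n) xs) F ≡ ∑ xs (λ a → ∑ (allFunsTo n xs) (λ f → F (a VF.∷ f)))
  ∑-allFunsTo-suc n xs F =
    trans (∑-concatMap (λ a → map (a VF.∷_) (allFunsTo n xs)) xs F)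
          (∑-cong xs (λ a → ∑-map (a VF.∷_) (allFunsTo n xs) F))

  -- Restricting a joined vector gives back its two parts only pointwise, hence the congruence
  -- hypothesis on `G`.
  ∑-allFunsTo-+ : {A : Set} (m n : ℕ) (xs : List A) (G : (Fin m → A) → (Fin n → A) → C) →
    (∀ {a a′ b b′} → (∀ i → a i ≡ a′ i) → (∀ i → b i ≡ b′ i) → G a b ≡ G a′ b′) →
    ∑ (allFunsTo (m + n) xs) (λ x → G (x ∘ (_↑ˡ n)) (x ∘ (m ↑ʳ_)))
      ≡ ∑ (allFunsTo m xs) (λ a → ∑ (allFunsTo n xs) (G a))
  ∑-allFunsTo-+ zero    n xs G G-cong =
    trans (∑-cong (allFunsTo n xs) (λ x → G-cong (λ ()) (λ _ → refl))) (sym (+-identityʳ _))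
  ∑-allFunsTo-+ (suc m) n xs G G-cong = begin
    ∑ (allFunsTo (suc m + n) xs) (λ x → G (x ∘ (_↑ˡ n)) (x ∘ (suc m ↑ʳ_)))
      ≡⟨ ∑-allFunsTo-suc (m + n) xs _ ⟩
    ∑ xs (λ a₀ → ∑ (allFunsTo (m + n) xs) (λ x → G ((a₀ VF.∷ x) ∘ (_↑ˡ n)) (x ∘ (m ↑ʳ_))))
      ≡⟨ ∑-cong xs (λ a₀ → ∑-cong (allFunsTo (m + n) xs) (λ x →
           G-cong (λ { zero → refl ; (suc i) → refl }) (λ _ → refl))) ⟩
    ∑ xs (λ a₀ → ∑ (allFunsTo (m + n) xs) (λ x → G (a₀ VF.∷ (x ∘ (_↑ˡ n))) (x ∘ (m ↑ʳ_))))
      ≡⟨ ∑-cong xs (λ a₀ → ∑-allFunsTo-+ m n xs (λ a → G (a₀ VF.∷ a)) (λ a≗a′ →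
           G-cong (λ { zero → refl ; (suc i) → a≗a′ i }))) ⟩
    ∑ xs (λ a₀ → ∑ (allFunsTo m xs) (λ a → ∑ (allFunsTo n xs) (G (a₀ VF.∷ a))))
      ≡⟨ ∑-allFunsTo-suc m xs _ ⟨
    ∑ (allFunsTo (suc m) xs) (λ a → ∑ (allFunsTo n xs) (G a)) ∎

  ∏-cong : ∀ n {h h′ : Fin n → C} → (∀ i → h i ≡ h′ i) → ∏ n h ≡ ∏ n h′
  ∏-cong zero    eq = refl
  ∏-cong (suc n) eq = cong₂ _∙_ (eq zero) (∏-cong n (eq ∘ suc))

  -- Distributivity over all choice functions. This is what lets independent coordinates of a point,
  -- or slices of a tensor, be summed separately.
  ∑-∏ : {A : Set} (n : ℕ) (xs : List A) (h : Fin n → A → C) →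
        ∑ (allFunsTo n xs) (λ f → ∏ n (λ i → h i (f i))) ≡ ∏ n (λ i → ∑ xs (h i))
  ∑-∏ zero    xs h = +-identityʳ 1#
  ∑-∏ (suc n) xs h = begin
    ∑ (allFunsTo (suc n) xs) (λ f → ∏ (suc n) (λ i → h i (f i)))
      ≡⟨ ∑-allFunsTo-suc n xs _ ⟩
    ∑ xs (λ a → ∑ (allFunsTo n xs) (λ f → h zero a ∙ ∏ n (λ i → h (suc i) (f i))))
      ≡⟨ ∑-cong xs (λ a → sym (*-distribˡ-∑ (allFunsTo n xs) (h zero a) _)) ⟩
    ∑ xs (λ a → h zero a ∙ ∑ (allFunsTo n xs) (λ f → ∏ n (λ i → h (suc i) (f i))))
      ≡⟨ sym (*-distribʳ-∑ xs _ (h zero)) ⟩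
    ∑ xs (h zero) ∙ ∑ (allFunsTo n xs) (λ f → ∏ n (λ i → h (suc i) (f i)))
      ≡⟨ cong (∑ xs (h zero) ∙_) (∑-∏ n xs (h ∘ suc)) ⟩
    ∑ xs (h zero) ∙ ∏ n (λ i → ∑ xs (h (suc i))) ∎

module ℕ∑ = Summation ℕₚ.+-*-isCommutativeSemiring
module 𝔹∑ = Summation (CommutativeRing.isCommutativeSemiring Boolₚ.xor-∧-commutativeRing)
module ℤ∑ = Summation ℤₚ.+-*-isCommutativeSemiring
open ℕ∑

∑-mono : {A : Set} (xs : List A) {F G : A → ℕ} → (∀ x → F x ≤ G x) → ∑ xs F ≤ ∑ xs G
∑-mono []       le = z≤n
∑-mono (x ∷ xs) le = ℕₚ.+-mono-≤ (le x) (∑-mono xs le)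

∑-const : {A : Set} (xs : List A) (c : ℕ) → ∑ xs (λ _ → c) ≡ length xs * c
∑-const []       c = refl
∑-const (x ∷ xs) c = cong (λ z → c + z) (∑-const xs c)

∣∑∣≤∑∣∣ : {A : Set} (xs : List A) (F : A → ℤ) → ℤ.∣ ℤ∑.∑ xs F ∣ ≤ ∑ xs (λ x → ℤ.∣ F x ∣)
∣∑∣≤∑∣∣ []       F = z≤n
∣∑∣≤∑∣∣ (x ∷ xs) F = ℕₚ.≤-trans (ℤₚ.∣i+j∣≤∣i∣+∣j∣ (F x) (ℤ∑.∑ xs F))
                                 (ℕₚ.+-monoʳ-≤ ℤ.∣ F x ∣ (∣∑∣≤∑∣∣ xs F))

∑-+ : {A : Set} (xs : List A) (F : A → ℕ) → ℤ∑.∑ xs (λ x → ℤ.+ F x) ≡ ℤ.+ ∑ xs F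
∑-+ []       F = refl
∑-+ (x ∷ xs) F = cong (ℤ._+_ (ℤ.+ F x)) (∑-+ xs F)

∏-+ : ∀ n (h : Fin n → ℕ) → ℤ∑.∏ n (λ i → ℤ.+ h i) ≡ ℤ.+ ∏ n h
∏-+ zero    h = refl
∏-+ (suc n) h = trans (cong (ℤ._*_ (ℤ.+ h zero)) (∏-+ n (h ∘ suc))) (sym (ℤₚ.pos-* (h zero) _))

∏-const : ∀ n c → ∏ n (λ _ → c) ≡ c ^ n
∏-const zero    c = refl
∏-const (suc n) c = cong (c *_) (∏-const n c)

∏-* : ∀ n (g h : Fin n → ℕ) → ∏ n (λ i → g i * h i) ≡ ∏ n g * ∏ n h
∏-* zero    g h = refl
∏-* (suc n) g h = trans (cong (g zero * h zero *_) (∏-* n (g ∘ suc) (h ∘ suc)))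
                        (ℕₚ.[m*n]*[o*p]≡[m*o]*[n*p] (g zero) (h zero) _ _)

^-distribʳ-* : ∀ n a b → (a * b) ^ n ≡ a ^ n * b ^ n
^-distribʳ-* zero    a b = refl
^-distribʳ-* (suc n) a b = trans (cong (a * b *_) (^-distribʳ-* n a b))
                                 (ℕₚ.[m*n]*[o*p]≡[m*o]*[n*p] a b _ _)

length-∑ : {A : Set} (xs : List A) → length xs ≡ ∑ xs (λ _ → 1)
length-∑ xs = sym (trans (∑-const xs 1) (ℕₚ.*-identityʳ _))

length-allFunsTo : {A : Set} (n : ℕ) (xs : List A) → length (allFunsTo n xs) ≡ length xs ^ n
length-allFunsTo zero    xs = refl
length-allFunsTo (suc n) xs = begin
  length (allFunsTo (suc n) xs)                    ≡⟨ length-∑ (allFunsTo (suc n) xs) ⟩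
  ∑ (allFunsTo (suc n) xs) (λ _ → 1)               ≡⟨ ∑-allFunsTo-suc n xs _ ⟩
  ∑ xs (λ _ → ∑ (allFunsTo n xs) (λ _ → 1))        ≡⟨ ∑-const xs _ ⟩
  length xs * ∑ (allFunsTo n xs) (λ _ → 1)         ≡⟨ cong (length xs *_) (sym (length-∑ (allFunsTo n xs))) ⟩
  length xs * length (allFunsTo n xs)              ≡⟨ cong (length xs *_) (length-allFunsTo n xs) ⟩
  length xs * length xs ^ n                        ∎
  where open ≡-Reasoning

-- Indicators, counting and finite vector spaces over F₂.

bit : Bool → ℕ
bit false = 0
bit true  = 1

bit-≤1 : ∀ b → bit b ≤ 1
bit-≤1 false = z≤n
bit-≤1 true  = s≤s z≤n

bit-mono : ∀ {b c} → (b ≡ true → c ≡ true) → bit b ≤ bit c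
bit-mono {false}     imp = z≤n
bit-mono {true}  {c} imp rewrite imp refl = s≤s z≤n

bit-∧ : ∀ b c → bit (b ∧ c) ≡ bit b * bit c
bit-∧ false c = refl
bit-∧ true  c = sym (ℕₚ.+-identityʳ _)

count : {A : Set} → List A → (A → Bool) → ℕ
count xs p = ∑ xs (λ x → bit (p x))

some-or-none : {A : Set} (xs : List A) (p : A → Bool) → (∃ λ x → p x ≡ true) ⊎ (count xs p ≡ 0)
some-or-none []       p = inj₂ refl
some-or-none (x ∷ xs) p with p x in eq
... | true  = inj₁ (x , eq)
... | false = some-or-none xs p

-- A finite abelian group of exponent two (id is its inverse), enumerated by xs up to _≈_.
record FinSpace (A : Set) (xs : List A) : Set₁ where
  infix  4 _≈_
  infixl 6 _⊕_
  field
    _≈_            : A → A → Set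
    _⊕_            : A → A → A
    𝟘              : A
    isAbelianGroup : IsAbelianGroup _≈_ _⊕_ 𝟘 id

  Respects : {C : Set} → (A → C) → Set
  Respects F = ∀ {x y} → x ≈ y → F x ≡ F y

  field
    -- The subspace arguments ask just two things of the enumeration: every element occurs up to
    -- `_≈_`, and translations permute it.
    term≤∑  : (F : A → ℕ) → Respects F → ∀ x → F x ≤ ∑ xs F
    ∑-shift : (F : A → ℕ) → Respects F → ∀ r → ∑ xs (λ x → F (x ⊕ r)) ≡ ∑ xs F

  open IsAbelianGroup isAbelianGroup public
    using ()
    renaming (refl to ≈-refl; sym to ≈-sym; trans to ≈-trans; ∙-cong to ⊕-cong; assoc to ⊕-assoc
             ; comm to ⊕-comm; identityˡ to ⊕-identityˡ; identityʳ to ⊕-identityʳ; inverseʳ to ⊕-self)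

  infixr 7 _·_
  _·_ : Bool → A → A
  false · v = 𝟘
  true  · v = v

  ·-cong : ∀ b {v w} → v ≈ w → b · v ≈ b · w
  ·-cong false v≈w = ≈-refl
  ·-cong true  v≈w = v≈w

  ·-congˡ : ∀ {b c} v → b ≡ c → b · v ≈ c · v
  ·-congˡ v refl = ≈-refl

  ·-zero : ∀ b → b · 𝟘 ≈ 𝟘
  ·-zero false = ≈-refl
  ·-zero true  = ≈-refl

  ·-distribˡ-⊕ : ∀ b v w → b · (v ⊕ w) ≈ b · v ⊕ b · w
  ·-distribˡ-⊕ false v w = ≈-sym (⊕-identityˡ 𝟘)
  ·-distribˡ-⊕ true  v w = ≈-refl

  ⊕-cancelʳ : ∀ v w → (v ⊕ w) ⊕ w ≈ v
  ⊕-cancelʳ v w =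
    ≈-trans (⊕-assoc v w w) (≈-trans (⊕-cong ≈-refl (⊕-self w)) (⊕-identityʳ v))

  ·-xor-cancel : ∀ b c v → (b xor c) · v ⊕ c · v ≈ b · v
  ·-xor-cancel false c     v = ⊕-self (c · v)
  ·-xor-cancel true  false v = ⊕-identityʳ v
  ·-xor-cancel true  true  v = ⊕-identityˡ v

  ⊕-medial : ∀ a b c d → (a ⊕ b) ⊕ (c ⊕ d) ≈ (a ⊕ c) ⊕ (b ⊕ d)
  ⊕-medial a b c d =
    ≈-trans (⊕-assoc a b (c ⊕ d)) (≈-trans (⊕-cong ≈-refl inner) (≈-sym (⊕-assoc a c (b ⊕ d))))
    where
    inner : b ⊕ (c ⊕ d) ≈ c ⊕ (b ⊕ d)
    inner = ≈-trans (≈-sym (⊕-assoc b c d))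
              (≈-trans (⊕-cong (⊕-comm b c) ≈-refl) (⊕-assoc c b d))

  record Subspace (V : A → Bool) : Set where
    field
      respects : Respects V
      zero∈ : V 𝟘 ≡ true
      ⊕∈   : ∀ {v w} → V v ≡ true → V w ≡ true → V (v ⊕ w) ≡ true

    bit-resp : Respects (bit ∘ V)
    bit-resp x≈y = cong bit (respects x≈y)

    ≈∈ : ∀ {v w} → v ≈ w → V v ≡ true → V w ≡ true
    ≈∈ v≈w v∈ = trans (sym (respects v≈w)) v∈

    count-pos : 1 ≤ count xs V
    count-pos = ℕₚ.≤-trans (ℕₚ.≤-reflexive (sym (cong bit zero∈))) (term≤∑ (bit ∘ V) bit-resp 𝟘)

boolSpace : FinSpace Bool allBools
boolSpace = record
  { _≈_ = _≡_
  ; _⊕_ = _xor_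
  ; 𝟘 = false
  ; isAbelianGroup = record
    { isGroup = record
      { isMonoid = record
        { isSemigroup = record
          { isMagma = record { isEquivalence = isEquivalence ; ∙-cong = cong₂ _xor_ }
          ; assoc = xor-assoc }
        ; identity = xor-identityˡ , xor-identityʳ }
      ; inverse = xor-same , xor-same
      ; ⁻¹-cong = id }
    ; comm = xor-comm }
  ; term≤∑ = λ { F _ false → ℕₚ.m≤m+n (F false) _
               ; F _ true  → ℕₚ.≤-trans (ℕₚ.m≤m+n (F true) 0) (ℕₚ.m≤n+m _ (F false)) }
  ; ∑-shift = λ { F _ false → refl
                ; F _ true  → trans (cong (F true +_) (ℕₚ.+-identityʳ (F false)))
                                (trans (ℕₚ.+-comm (F true) (F false))
                                  (cong (F false +_) (sym (ℕₚ.+-identityʳ (F true))))) }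
  }

power : ∀ {A xs} (n : ℕ) → FinSpace A xs → FinSpace (Fin n → A) (allFunsTo n xs)
power {A} {xs} n X = record
  { _≈_ = λ f g → ∀ i → f i ≈ g i
  ; _⊕_ = λ f g i → f i ⊕ g i
  ; 𝟘 = λ _ → 𝟘
  ; isAbelianGroup = Pointwise.isAbelianGroup (Fin n) isAbelianGroup
  ; term≤∑ = term n
  ; ∑-shift = shift n
  }
  where
  open FinSpace X

  Resp : ∀ n → ((Fin n → A) → ℕ) → Set
  Resp n F = ∀ {f g} → (∀ i → f i ≈ g i) → F f ≡ F g

  ∷-congˡ : ∀ {n} {a b : A} → a ≈ b → (f : Fin n → A) → ∀ i → (a VF.∷ f) i ≈ (b VF.∷ f) i
  ∷-congˡ a≈b f zero    = a≈b
  ∷-congˡ a≈b f (suc i) = ≈-refl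

  ∷-congʳ : ∀ {n} (a : A) {f g : Fin n → A} → (∀ i → f i ≈ g i) →
            ∀ i → (a VF.∷ f) i ≈ (a VF.∷ g) i
  ∷-congʳ a f≈g zero    = ≈-refl
  ∷-congʳ a f≈g (suc i) = f≈g i

  term : ∀ n (F : (Fin n → A) → ℕ) → Resp n F → ∀ f → F f ≤ ∑ (allFunsTo n xs) F
  term zero    F F-resp f = ℕₚ.≤-trans (ℕₚ.≤-reflexive (F-resp λ ())) (ℕₚ.m≤m+n _ 0)
  term (suc n) F F-resp f = begin
    F f                       ≡⟨ F-resp (λ { zero → ≈-refl ; (suc i) → ≈-refl }) ⟩
    F (f zero VF.∷ f ∘ suc)   ≤⟨ term n (F ∘ (f zero VF.∷_)) (F-resp ∘ ∷-congʳ (f zero)) (f ∘ suc) ⟩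
    ∑ (allFunsTo n xs) (λ g → F (f zero VF.∷ g))
      ≤⟨ term≤∑ _ (λ a≈b → ∑-cong (allFunsTo n xs) (λ g → F-resp (∷-congˡ a≈b g))) (f zero) ⟩
    ∑ xs (λ a → ∑ (allFunsTo n xs) (λ g → F (a VF.∷ g)))  ≡⟨ ∑-allFunsTo-suc n xs F ⟨
    ∑ (allFunsTo (suc n) xs) F ∎
    where open ≤-Reasoning

  shift : ∀ n (F : (Fin n → A) → ℕ) → Resp n F → (r : Fin n → A) →
          ∑ (allFunsTo n xs) (λ f → F (λ i → f i ⊕ r i)) ≡ ∑ (allFunsTo n xs) F
  shift zero    F F-resp r = cong (_+ 0) (F-resp λ ())
  shift (suc n) F F-resp r = begin
    ∑ (allFunsTo (suc n) xs) (λ f → F (λ i → f i ⊕ r i))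
      ≡⟨ ∑-allFunsTo-suc n xs _ ⟩
    ∑ xs (λ a → ∑ (allFunsTo n xs) (λ f → F (λ i → (a VF.∷ f) i ⊕ r i)))
      ≡⟨ ∑-cong xs (λ a → ∑-cong (allFunsTo n xs) (λ f →
           F-resp (λ { zero → ≈-refl ; (suc i) → ≈-refl }))) ⟩
    ∑ xs (λ a → ∑ (allFunsTo n xs) (λ f → F ((a ⊕ r zero) VF.∷ (λ i → f i ⊕ r (suc i)))))
      ≡⟨ ∑-cong xs (λ a → shift n _ (F-resp ∘ ∷-congʳ (a ⊕ r zero)) (r ∘ suc)) ⟩
    ∑ xs (λ a → ∑ (allFunsTo n xs) (λ f → F ((a ⊕ r zero) VF.∷ f)))
      ≡⟨ ∑-shift (λ a → ∑ (allFunsTo n xs) (λ f → F (a VF.∷ f)))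
           (λ a≈b → ∑-cong (allFunsTo n xs) (λ f → F-resp (∷-congˡ a≈b f))) (r zero) ⟩
    ∑ xs (λ a → ∑ (allFunsTo n xs) (λ f → F (a VF.∷ f)))
      ≡⟨ ∑-allFunsTo-suc n xs F ⟨
    ∑ (allFunsTo (suc n) xs) F ∎
    where open ≡-Reasoning

tensorSpace : ∀ d k → FinSpace (Tensor d k) (allTensors d k)
tensorSpace zero    k = boolSpace
tensorSpace (suc d) k = power k (tensorSpace d k)

-- Fibres of a subspace of Aⁿ along the products a ⊗ w.

≤ᵇ-sound : ∀ m n → (m ≤ᵇ n) ≡ true → m ≤ n
≤ᵇ-sound m n eq = ℕₚ.≤ᵇ⇒≤ m n (Equivalence.from Boolₚ.T-≡ eq)

≤ᵇ-complete : ∀ m n → m ≤ n → (m ≤ᵇ n) ≡ true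
≤ᵇ-complete m n le = Equivalence.to Boolₚ.T-≡ (ℕₚ.≤⇒≤ᵇ le)

module Fibres {A : Set} {xs : List A} (X : FinSpace A xs) where
  open FinSpace X
  private
    module Power n = FinSpace (power n X)

  infixr 7 _⊗_
  _⊗_ : ∀ {n} → (Fin n → Bool) → A → Fin n → A
  (a ⊗ w) i = a i · w

  fibre : ∀ {n} → ((Fin n → A) → Bool) → (Fin n → Bool) → A → Bool
  fibre V a w = V (a ⊗ w)

  large : ∀ {n} → ℕ → ((Fin n → A) → Bool) → (Fin n → Bool) → Bool
  large B V a = B ≤ᵇ count xs (fibre V a)

  large-mono : ∀ {m n} B (V : (Fin m → A) → Bool) a (V′ : (Fin n → A) → Bool) b →
               (∀ w → fibre V a w ≡ true → fibre V′ b w ≡ true) →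
               bit (large B V a) ≤ bit (large B V′ b)
  large-mono B V a V′ b imp = bit-mono λ big →
    ≤ᵇ-complete B _ (ℕₚ.≤-trans (≤ᵇ-sound B _ big) (∑-mono xs (λ w → bit-mono (imp w))))

  fibre-subspace : ∀ {n V} → Power.Subspace n V → ∀ a → Subspace (fibre V a)
  fibre-subspace {n} {V} S a = record
    { respects = λ v≈w → respects (λ i → ·-cong (a i) v≈w)
    ; zero∈ = ≈∈ (λ i → ≈-sym (·-zero (a i))) zero∈
    ; ⊕∈ = λ {v} {w} v∈ w∈ → ≈∈ (λ i → ≈-sym (·-distribˡ-⊕ (a i) v w)) (⊕∈ v∈ w∈)
    }
    where open Power.Subspace n S

  -- The image of V in the quotient of Aⁿ⁺¹ by (1,a) ⊗ A, where the quotient map is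
  -- (v₀ , v) ↦ v ⊕ a ⊗ v₀; it sends (b₀ , b) ⊗ w to (b xor b₀a) ⊗ w.
  module Quotient {n} {V : (Fin (suc n) → A) → Bool} (S : Power.Subspace (suc n) V)
                  (a : Fin n → Bool) where
    open Power.Subspace (suc n) S
    private
      module Pₙ = Power n

    -- For fixed `v`, the elements `lift v₀ v` run through the preimage of `v` under the quotient
    -- map, so `size v` counts the part of `V` above `v`.
    lift : A → (Fin n → A) → Fin (suc n) → A
    lift v₀ v = v₀ VF.∷ (v Pₙ.⊕ a ⊗ v₀)

    lift-cong : ∀ {v₀ w₀ v w} → v₀ ≈ w₀ → v Pₙ.≈ w → ∀ i → lift v₀ v i ≈ lift w₀ w i
    lift-cong v₀≈w₀ v≈w zero    = v₀≈w₀
    lift-cong v₀≈w₀ v≈w (suc i) = ⊕-cong (v≈w i) (·-cong (a i) v₀≈w₀)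

    lift-⊕ : ∀ v₀ w₀ v w i → lift v₀ v i ⊕ lift w₀ w i ≈ lift (v₀ ⊕ w₀) (v Pₙ.⊕ w) i
    lift-⊕ v₀ w₀ v w zero    = ≈-refl
    lift-⊕ v₀ w₀ v w (suc i) =
      ≈-trans (⊕-medial (v i) _ (w i) _) (⊕-cong ≈-refl (≈-sym (·-distribˡ-⊕ (a i) v₀ w₀)))

    size : (Fin n → A) → ℕ
    size v = count xs (λ v₀ → V (lift v₀ v))

    size-resp : Pₙ.Respects size
    size-resp v≈w = ∑-cong xs (λ v₀ → bit-resp (lift-cong ≈-refl v≈w))

    V/ : (Fin n → A) → Bool
    V/ v = 1 ≤ᵇ size v

    V/-intro : ∀ v₀ {v} → V (lift v₀ v) ≡ true → V/ v ≡ true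
    V/-intro v₀ {v} v∈ = ≤ᵇ-complete 1 (size v) (begin
      1                    ≡⟨ cong bit v∈ ⟨
      bit (V (lift v₀ v))  ≤⟨ term≤∑ _ (λ eq → bit-resp (lift-cong eq (λ _ → ≈-refl))) v₀ ⟩
      size v               ∎)
      where open ≤-Reasoning

    V/-elim : ∀ {v} → V/ v ≡ true → ∃ λ v₀ → V (lift v₀ v) ≡ true
    V/-elim {v} v∈ with some-or-none xs (λ v₀ → V (lift v₀ v))
    ... | inj₁ some = some
    ... | inj₂ none with () ← ℕₚ.≤-trans (≤ᵇ-sound 1 (size v) v∈) (ℕₚ.≤-reflexive none)

    V/-subspace : Pₙ.Subspace V/
    V/-subspace = record
      { respects = λ v≈w → cong (1 ≤ᵇ_) (size-resp v≈w)
      ; zero∈ = V/-intro 𝟘 (≈∈ (λ { zero → ≈-refl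
                                 ; (suc i) → ≈-sym (≈-trans (⊕-identityˡ _) (·-zero (a i))) }) zero∈)
      ; ⊕∈ = λ {v} {w} v∈ w∈ →
          let v₀ , v₀∈ = V/-elim v∈
              w₀ , w₀∈ = V/-elim w∈
          in V/-intro (v₀ ⊕ w₀) (≈∈ (lift-⊕ v₀ w₀ v w) (⊕∈ v₀∈ w₀∈))
      }

    -- For each first coordinate `v₀`, `lift v₀` only translates the remaining coordinates by
    -- `a ⊗ v₀`.
    ∑-size : ∑ (allFunsTo n xs) size ≡ count (allFunsTo (suc n) xs) V
    ∑-size = begin
      ∑ vs (λ v → ∑ xs (λ v₀ → bit (V (lift v₀ v))))
        ≡⟨ ∑-swap vs xs _ ⟩
      ∑ xs (λ v₀ → ∑ vs (λ v → bit (V (lift v₀ v))))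
        ≡⟨ ∑-cong xs (λ v₀ → Pₙ.∑-shift (λ v → bit (V (v₀ VF.∷ v))) (λ v≈w → bit-resp
             (λ { zero → ≈-refl ; (suc i) → v≈w i })) (a ⊗ v₀)) ⟩
      ∑ xs (λ v₀ → ∑ vs (λ v → bit (V (v₀ VF.∷ v))))
        ≡⟨ ∑-allFunsTo-suc n xs _ ⟨
      count (allFunsTo (suc n) xs) V ∎
      where open ≡-Reasoning
            vs = allFunsTo n xs

    -- Every nonempty coset of the fibre has the size of the fibre.
    fibre≤size : ∀ {v} → V/ v ≡ true → count xs (fibre V (true VF.∷ a)) ≤ size v
    fibre≤size {v} v∈ = begin
      count xs (fibre V (true VF.∷ a))
        ≤⟨ ∑-mono xs (λ w → bit-mono (λ w∈ → ≈∈ (shifted w) (⊕∈ w∈ v₀∈))) ⟩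
      ∑ xs (λ w → bit (V (lift (w ⊕ v₀) v)))
        ≡⟨ ∑-shift _ (λ eq → bit-resp (lift-cong eq (λ _ → ≈-refl))) v₀ ⟩
      size v ∎
      where
      open ≤-Reasoning
      v₀ = proj₁ (V/-elim v∈)
      v₀∈ = proj₂ (V/-elim v∈)
      shifted : ∀ w i → ((true VF.∷ a) ⊗ w) i ⊕ lift v₀ v i ≈ lift (w ⊕ v₀) v i
      shifted w zero    = ≈-refl
      shifted w (suc i) =
        ≈-trans (⊕-cong (≈-sym (⊕-identityˡ _)) ≈-refl)
          (≈-trans (lift-⊕ w v₀ Pₙ.𝟘 v (suc i)) (⊕-cong (⊕-identityˡ (v i)) ≈-refl))

    -- The fibre over (1,a) is the kernel of the quotient map on `V`, and above each point of the
    -- image lies a full coset of it.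
    count-V/ : count (allFunsTo n xs) V/ * count xs (fibre V (true VF.∷ a))
               ≤ count (allFunsTo (suc n) xs) V
    count-V/ = begin
      count vs V/ * f                 ≡⟨ *-distribʳ-∑ vs f (bit ∘ V/) ⟩
      ∑ vs (λ v → bit (V/ v) * f)     ≤⟨ ∑-mono vs bound ⟩
      ∑ vs size                       ≡⟨ ∑-size ⟩
      count (allFunsTo (suc n) xs) V  ∎
      where
      open ≤-Reasoning
      vs = allFunsTo n xs
      f = count xs (fibre V (true VF.∷ a))
      bound : ∀ v → bit (V/ v) * f ≤ size v
      bound v with V/ v in eq
      ... | false = z≤n
      ... | true  = ℕₚ.≤-trans (ℕₚ.≤-reflexive (ℕₚ.+-identityʳ f)) (fibre≤size eq)

    -- This and `fibre-true` carry the fibre over a point into the fibre over its image, so large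
    -- fibres stay large in the quotient.
    fibre-false : ∀ b w → fibre V (false VF.∷ b) w ≡ true → fibre V/ b w ≡ true
    fibre-false b w w∈ = V/-intro 𝟘 (≈∈ eq w∈)
      where
      eq : ∀ i → ((false VF.∷ b) ⊗ w) i ≈ lift 𝟘 (b ⊗ w) i
      eq zero    = ≈-refl
      eq (suc i) = ≈-sym (≈-trans (⊕-cong ≈-refl (·-zero (a i))) (⊕-identityʳ _))

    fibre-true : ∀ b w → fibre V (true VF.∷ b) w ≡ true →
                 fibre V/ (λ i → b i xor a i) w ≡ true
    fibre-true b w w∈ = V/-intro w (≈∈ eq w∈)
      where
      eq : ∀ i → ((true VF.∷ b) ⊗ w) i ≈ lift w ((λ i → b i xor a i) ⊗ w) i
      eq zero    = ≈-refl
      eq (suc i) = ≈-sym (·-xor-cancel (b i) (a i) w)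

  module Slice {n} {V : (Fin (suc n) → A) → Bool} (S : Power.Subspace (suc n) V) where
    open Power.Subspace (suc n) S

    V₀ : (Fin n → A) → Bool
    V₀ v = V (𝟘 VF.∷ v)

    V₀-subspace : Power.Subspace n V₀
    V₀-subspace = record
      { respects = λ v≈w → respects (λ { zero → ≈-refl ; (suc i) → v≈w i })
      ; zero∈ = ≈∈ (λ { zero → ≈-refl ; (suc i) → ≈-refl }) zero∈
      ; ⊕∈ = λ v∈ w∈ → ≈∈ (λ { zero → ⊕-identityˡ 𝟘 ; (suc i) → ≈-refl }) (⊕∈ v∈ w∈)
      }

    count-V₀ : count (allFunsTo n xs) V₀ ≤ count (allFunsTo (suc n) xs) V
    count-V₀ = begin
      count vs V₀
        ≤⟨ term≤∑ (λ v₀ → ∑ vs (λ v → bit (V (v₀ VF.∷ v)))) (λ eq → ∑-cong vs (λ v →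
             bit-resp (λ { zero → eq ; (suc i) → ≈-refl }))) 𝟘 ⟩
      ∑ xs (λ v₀ → ∑ vs (λ v → bit (V (v₀ VF.∷ v))))
        ≡⟨ ∑-allFunsTo-suc n xs _ ⟨
      count (allFunsTo (suc n) xs) V ∎
      where open ≤-Reasoning
            vs = allFunsTo n xs

    fibre-false : ∀ b w → fibre V (false VF.∷ b) w ≡ true → fibre V₀ b w ≡ true
    fibre-false b w = ≈∈ (λ { zero → ≈-refl ; (suc i) → ≈-refl })

  -- Fibres over linearly independent points span their direct sum inside V.
  few-large-fibres : ∀ n s {V : (Fin n → A) → Bool} → Power.Subspace n V → ∀ B →
                     count (allFunsTo n xs) V < B ^ s →
                     count (allVecs n) (large B V) ≤ 2 ^ s
  few-large-fibres zero s {V} S B small =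
    ℕₚ.≤-trans (ℕₚ.≤-reflexive (ℕₚ.+-identityʳ _)) (ℕₚ.≤-trans (bit-≤1 _) (ℕₚ.m^n>0 2 s))
  few-large-fibres (suc n) s {V} S B small
    with some-or-none (allVecs n) (λ a → large B V (true VF.∷ a))
  -- All large points have first coordinate 0, so they already appear in the slice of `V` with first
  -- coordinate 0.
  ... | inj₂ none = begin
    count (allVecs (suc n)) (large B V)
      ≡⟨ ∑-allFunsTo-suc n allBools _ ⟩
    count (allVecs n) (λ b → large B V (false VF.∷ b))
      + (count (allVecs n) (λ b → large B V (true VF.∷ b)) + 0)
      ≡⟨ cong (λ z → count (allVecs n) (λ b → large B V (false VF.∷ b)) + (z + 0)) none ⟩
    count (allVecs n) (λ b → large B V (false VF.∷ b)) + 0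
      ≡⟨ ℕₚ.+-identityʳ _ ⟩
    count (allVecs n) (λ b → large B V (false VF.∷ b))
      ≤⟨ ∑-mono (allVecs n) (λ b → large-mono B V (false VF.∷ b) V₀ b (fibre-false b)) ⟩
    count (allVecs n) (large B V₀)
      ≤⟨ few-large-fibres n s V₀-subspace B (ℕₚ.≤-<-trans count-V₀ small) ⟩
    2 ^ s ∎
    where open ≤-Reasoning
          open Slice S
  -- A subspace contains 0, so it cannot have fewer than B^0 = 1 elements.
  few-large-fibres (suc n) zero {V} S B small | inj₁ _
    with () ← ℕₚ.≤⇒≯ (Power.Subspace.count-pos (suc n) S) small
  -- The quotient by one large fibre divides the size of `V` by at least `B`, which lowers `s` by
  -- one. The map (b₀,b) ↦ b xor b₀a is two-to-one, which costs the factor 2.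
  few-large-fibres (suc n) (suc s) {V} S B small | inj₁ (a , big) = begin
    count (allVecs (suc n)) (large B V)
      ≡⟨ ∑-allFunsTo-suc n allBools _ ⟩
    count (allVecs n) (λ b → large B V (false VF.∷ b))
      + (count (allVecs n) (λ b → large B V (true VF.∷ b)) + 0)
      ≤⟨ ℕₚ.+-mono-≤
           (∑-mono (allVecs n) (λ b → large-mono B V (false VF.∷ b) V/ b (fibre-false b)))
           (ℕₚ.+-monoˡ-≤ 0 (∑-mono (allVecs n) (λ b → large-mono B V (true VF.∷ b) V/ (λ i → b i xor a i) (fibre-true b)))) ⟩
    count (allVecs n) (large B V/) + (count (allVecs n) (λ b → large B V/ (λ i → b i xor a i)) + 0)
      ≡⟨ cong (λ z → count (allVecs n) (large B V/) + (z + 0))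
           (FinSpace.∑-shift (power n boolSpace) (bit ∘ large B V/) large-resp a) ⟩
    2 * count (allVecs n) (large B V/)
      ≤⟨ ℕₚ.*-monoʳ-≤ 2 (few-large-fibres n s V/-subspace B V/-small) ⟩
    2 * 2 ^ s ∎
    where
    open ≤-Reasoning
    open Quotient S a

    large-resp : FinSpace.Respects (power n boolSpace) (bit ∘ large B V/)
    large-resp b≡c = cong (λ z → bit (B ≤ᵇ z)) (∑-cong xs (λ w →
      Power.Subspace.bit-resp n V/-subspace (λ i → ·-congˡ w (b≡c i))))

    V/-small : count (allFunsTo n xs) V/ < B ^ s
    V/-small = ℕₚ.*-cancelʳ-< (count xs (fibre V (true VF.∷ a))) _ _ (begin-strict
      count (allFunsTo n xs) V/ * count xs (fibre V (true VF.∷ a))  ≤⟨ count-V/ ⟩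
      count (allFunsTo (suc n) xs) V                                <⟨ small ⟩
      B * B ^ s                                                     ≡⟨ ℕₚ.*-comm B _ ⟩
      B ^ s * B                                                     ≤⟨ ℕₚ.*-monoʳ-≤ (B ^ s) (≤ᵇ-sound B _ big) ⟩
      B ^ s * count xs (fibre V (true VF.∷ a))                      ∎)

-- Tensors, their pairing and the characters it defines.

andFin-intro : ∀ n {h : Fin n → Bool} → (∀ i → h i ≡ true) → andFin n h ≡ true
andFin-intro zero    all = refl
andFin-intro (suc n) all = cong₂ _∧_ (all zero) (andFin-intro n (all ∘ suc))

andFin-elim : ∀ n {h : Fin n → Bool} → andFin n h ≡ true → ∀ i → h i ≡ true
andFin-elim (suc n) {h} eq i with h zero in eq₀
andFin-elim (suc n) {h} eq zero    | true = eq₀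
andFin-elim (suc n) {h} eq (suc i) | true = andFin-elim n eq i

andFin-cong : ∀ n {g h : Fin n → Bool} → (∀ i → g i ≡ h i) → andFin n g ≡ andFin n h
andFin-cong zero    eq = refl
andFin-cong (suc n) eq = cong₂ _∧_ (eq zero) (andFin-cong n (eq ∘ suc))

bit-andFin : ∀ n (h : Fin n → Bool) → bit (andFin n h) ≡ ∏ n (bit ∘ h)
bit-andFin zero    h = refl
bit-andFin (suc n) h = trans (bit-∧ (h zero) _) (cong (bit (h zero) *_) (bit-andFin n (h ∘ suc)))

xorFin : (n : ℕ) → (Fin n → Bool) → Bool
xorFin zero    h = false
xorFin (suc n) h = h zero xor xorFin n (h ∘ suc)

xorFin-cong : ∀ n {g h : Fin n → Bool} → (∀ i → g i ≡ h i) → xorFin n g ≡ xorFin n h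
xorFin-cong zero    eq = refl
xorFin-cong (suc n) eq = cong₂ _xor_ (eq zero) (xorFin-cong n (eq ∘ suc))

xorFin-false : ∀ n → xorFin n (λ _ → false) ≡ false
xorFin-false zero    = refl
xorFin-false (suc n) = xorFin-false n

xorFin-xor : ∀ n (g h : Fin n → Bool) → xorFin n (λ i → g i xor h i) ≡ xorFin n g xor xorFin n h
xorFin-xor zero    g h = refl
xorFin-xor (suc n) g h =
  trans (cong ((g zero xor h zero) xor_) (xorFin-xor n (g ∘ suc) (h ∘ suc)))
        (𝔹∑.medial (g zero) (h zero) _ _)

xorSum-tabulate : ∀ {A : Set} n (f : Fin n → A) (F : A → Bool) →
                  𝔹∑.∑ (tabulate f) F ≡ xorFin n (F ∘ f)
xorSum-tabulate zero    f F = refl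
xorSum-tabulate (suc n) f F = cong (F (f zero) xor_) (xorSum-tabulate n (f ∘ suc) F)

sign-xor : ∀ a b → sign (a xor b) ≡ sign a ℤ.* sign b
sign-xor false b     = sym (ℤₚ.*-identityˡ (sign b))
sign-xor true  false = refl
sign-xor true  true  = refl

sign-xorFin : ∀ n (h : Fin n → Bool) → sign (xorFin n h) ≡ ℤ∑.∏ n (sign ∘ h)
sign-xorFin zero    h = refl
sign-xorFin (suc n) h =
  trans (sign-xor (h zero) _) (cong (ℤ._*_ (sign (h zero))) (sign-xorFin n (h ∘ suc)))

module TensorSpace d k = FinSpace (tensorSpace d k)
module TensorFibres d k = Fibres (tensorSpace d k)

⟨_,_⟩ : ∀ {d k} → Tensor d k → Tensor d k → Bool
⟨_,_⟩ {zero}      a b = a ∧ b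
⟨_,_⟩ {suc d} {k} T R = xorFin k (λ i → ⟨_,_⟩ {d} {k} (T i) (R i))

⟨⟩-comm : ∀ d k (T R : Tensor d k) → ⟨_,_⟩ {d} {k} T R ≡ ⟨_,_⟩ {d} {k} R T
⟨⟩-comm zero    k T R = Boolₚ.∧-comm T R
⟨⟩-comm (suc d) k T R = xorFin-cong k (λ i → ⟨⟩-comm d k (T i) (R i))

⟨⟩-congʳ : ∀ d k (T : Tensor d k) {R S} → TensorSpace._≈_ d k R S →
           ⟨_,_⟩ {d} {k} T R ≡ ⟨_,_⟩ {d} {k} T S
⟨⟩-congʳ zero    k T eq = cong (T ∧_) eq
⟨⟩-congʳ (suc d) k T eq = xorFin-cong k (λ i → ⟨⟩-congʳ d k (T i) (eq i))

⟨⟩-zeroʳ : ∀ d k (T : Tensor d k) → ⟨_,_⟩ {d} {k} T (TensorSpace.𝟘 d k) ≡ false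
⟨⟩-zeroʳ zero    k T = Boolₚ.∧-zeroʳ T
⟨⟩-zeroʳ (suc d) k T = trans (xorFin-cong k (λ i → ⟨⟩-zeroʳ d k (T i))) (xorFin-false k)

⟨⟩-⊕ʳ : ∀ d k (T R S : Tensor d k) →
        ⟨_,_⟩ {d} {k} T (TensorSpace._⊕_ d k R S) ≡ ⟨_,_⟩ {d} {k} T R xor ⟨_,_⟩ {d} {k} T S
⟨⟩-⊕ʳ zero    k T R S = Boolₚ.∧-distribˡ-xor T R S
⟨⟩-⊕ʳ (suc d) k T R S =
  trans (xorFin-cong k (λ i → ⟨⟩-⊕ʳ d k (T i) (R i) (S i))) (xorFin-xor k _ _)

vanishes : ∀ d k → Tensor d k → Bool
vanishes zero    k b = not b
vanishes (suc d) k T = andFin k (λ i → vanishes d k (T i))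

-- The zero subspace is the span of no tensors, the starting point of the moment bound.
vanishes-subspace : ∀ d k → TensorSpace.Subspace d k (vanishes d k)
vanishes-subspace zero k = record
  { respects = cong not
  ; zero∈ = refl
  ; ⊕∈ = λ { {false} {false} _ _ → refl }
  }
vanishes-subspace (suc d) k = record
  { respects = λ eq → andFin-cong k (λ i → respects (eq i))
  ; zero∈ = andFin-intro k (λ _ → zero∈)
  ; ⊕∈ = λ v∈ w∈ → andFin-intro k (λ i → ⊕∈ (andFin-elim k v∈ i) (andFin-elim k w∈ i))
  }
  where open TensorSpace.Subspace d k (vanishes-subspace d k)

count-vanishes : ∀ d k → count (allTensors d k) (vanishes d k) ≡ 1
count-vanishes zero    k = refl
count-vanishes (suc d) k = begin
  ∑ (allTensors (suc d) k) (λ T → bit (andFin k (λ i → vanishes d k (T i))))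
    ≡⟨ ∑-cong (allTensors (suc d) k) (λ T → bit-andFin k _) ⟩
  ∑ (allTensors (suc d) k) (λ T → ∏ k (λ i → bit (vanishes d k (T i))))
    ≡⟨ ∑-∏ k (allTensors d k) (λ _ → bit ∘ vanishes d k) ⟩
  ∏ k (λ _ → count (allTensors d k) (vanishes d k))
    ≡⟨ ∏-cong k (λ _ → count-vanishes d k) ⟩
  ∏ k (λ _ → 1)
    ≡⟨ trans (∏-const k 1) (ℕₚ.^-zeroˡ k) ⟩
  1 ∎
  where open ≡-Reasoning

-- Orthogonality of characters. The slices of `T` are independent, so the sum is a product of
-- character sums of one order less.
∑-character : ∀ d k (R : Tensor d k) →
  ℤ∑.∑ (allTensors d k) (λ T → sign (⟨_,_⟩ {d} {k} T R))
    ≡ ℤ.+ (length (allTensors d k) * bit (vanishes d k R))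
∑-character zero    k false = refl
∑-character zero    k true  = refl
∑-character (suc d) k R = begin
  ℤ∑.∑ (allTensors (suc d) k) (λ T → sign (xorFin k (λ i → ⟨_,_⟩ {d} {k} (T i) (R i))))
    ≡⟨ ℤ∑.∑-cong (allTensors (suc d) k) (λ T → sign-xorFin k _) ⟩
  ℤ∑.∑ (allTensors (suc d) k) (λ T → ℤ∑.∏ k (λ i → sign (⟨_,_⟩ {d} {k} (T i) (R i))))
    ≡⟨ ℤ∑.∑-∏ k (allTensors d k) (λ i T → sign (⟨_,_⟩ {d} {k} T (R i))) ⟩
  ℤ∑.∏ k (λ i → ℤ∑.∑ (allTensors d k) (λ T → sign (⟨_,_⟩ {d} {k} T (R i))))
    ≡⟨ ℤ∑.∏-cong k (λ i → ∑-character d k (R i)) ⟩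
  ℤ∑.∏ k (λ i → ℤ.+ (L * bit (vanishes d k (R i))))
    ≡⟨ ∏-+ k _ ⟩
  ℤ.+ ∏ k (λ i → L * bit (vanishes d k (R i)))
    ≡⟨ cong ℤ.+_ (∏-* k (λ _ → L) _) ⟩
  ℤ.+ (∏ k (λ _ → L) * ∏ k (λ i → bit (vanishes d k (R i))))
    ≡⟨ cong ℤ.+_ (cong₂ _*_ (trans (∏-const k L) (sym (length-allFunsTo k (allTensors d k))))
                            (sym (bit-andFin k _))) ⟩
  ℤ.+ (length (allTensors (suc d) k) * bit (vanishes (suc d) k R)) ∎
  where open ≡-Reasoning
        L = length (allTensors d k)

rankOne : ∀ d k → (Fin d → Fin k → Bool) → Tensor d k
rankOne zero    k x = true
rankOne (suc d) k x = x zero ⊗ rankOne d k (x ∘ suc)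
  where open TensorFibres d k

rankOne-cong : ∀ d k {x y : Fin d → Fin k → Bool} → (∀ j i → x j i ≡ y j i) →
               TensorSpace._≈_ d k (rankOne d k x) (rankOne d k y)
rankOne-cong zero    k eq   = refl
rankOne-cong (suc d) k {x} eq i =
  ≈-trans (·-cong (x zero i) (rankOne-cong d k (eq ∘ suc))) (·-congˡ _ (eq zero i))
  where open TensorSpace d k

-- Makes the value of the form at a point a linear function of the tensor, so that its sign is a
-- character in `T`.
multilinearForm-⟨⟩ : ∀ d k (T : Tensor d k) x →
                     multilinearForm {d} {k} T x ≡ ⟨_,_⟩ {d} {k} T (rankOne d k x)
multilinearForm-⟨⟩ zero    k T x = xor-identityʳ _
multilinearForm-⟨⟩ (suc d) k T x = begin
  𝔹∑.∑ (allIdx (suc d) k) (λ idx → entry {suc d} {k} T idx ∧ andFin (suc d) (λ j → x j (idx j)))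
    ≡⟨ 𝔹∑.∑-allFunsTo-suc d (allFin k) _ ⟩
  𝔹∑.∑ (allFin k) (λ c → 𝔹∑.∑ (allIdx d k) (λ idx →
    entry {d} {k} (T c) idx ∧ (x zero c ∧ andFin d (λ j → x (suc j) (idx j)))))
    ≡⟨ 𝔹∑.∑-cong (allFin k) (λ c → row (T c) (x zero c)) ⟩
  𝔹∑.∑ (allFin k) (λ c → ⟨_,_⟩ {d} {k} (T c) (x zero c · rankOne d k (x ∘ suc)))
    ≡⟨ xorSum-tabulate k id _ ⟩
  ⟨_,_⟩ {suc d} {k} T (rankOne (suc d) k x) ∎
  where
  open ≡-Reasoning
  open TensorSpace d k
  row : ∀ (S : Tensor d k) b →
    𝔹∑.∑ (allIdx d k) (λ idx → entry {d} {k} S idx ∧ (b ∧ andFin d (λ j → x (suc j) (idx j))))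
      ≡ ⟨_,_⟩ {d} {k} S (b · rankOne d k (x ∘ suc))
  row S false = trans (trans (𝔹∑.∑-cong (allIdx d k) (λ idx → Boolₚ.∧-zeroʳ _)) (𝔹∑.∑-zero (allIdx d k)))
                      (sym (⟨⟩-zeroʳ d k S))
  row S true  = multilinearForm-⟨⟩ d k S (x ∘ suc)

tens : ∀ d k → (Fin (d * k) → Bool) → Tensor d k
tens d k x = rankOne d k (λ j i → x (combine j i))

tens-cong : ∀ d k {x y : Fin (d * k) → Bool} → (∀ i → x i ≡ y i) →
            TensorSpace._≈_ d k (tens d k x) (tens d k y)
tens-cong d k eq = rankOne-cong d k (λ j i → eq (combine j i))

-- Rank-one tensors in a small subspace.

length-allVecs : ∀ n → length (allVecs n) ≡ 2 ^ n
length-allVecs n = length-allFunsTo n allBools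

-- Each of the m factors contributes 2^(s - k), the chance that its vector is one of at most 2^s
-- points with a large fibre. Lowering the order replaces the size bound 2^(s^(m+1)) by its s-th
-- root, which is the value of `B`.
few-rankOne : ∀ m k s {V} → TensorSpace.Subspace m k V → count (allTensors m k) V < 2 ^ (s ^ m) →
              2 ^ k * count (allVecs (m * k)) (V ∘ tens m k) ≤ m * 2 ^ (s + m * k)
-- In order zero the bound reads 2^(s^0) = 2, so `V` is zero and misses `true`, the only rank-one
-- tensor.
few-rankOne zero    k s {V} S small with V true in V-true
... | false = ℕₚ.≤-reflexive (ℕₚ.*-zeroʳ (2 ^ k))
... | true with () ← ℕₚ.≤⇒≯ (ℕₚ.≤-reflexive (sym (cong (λ b → bit b + 1) (TensorSpace.Subspace.zero∈ {zero} {k} S)))) small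
few-rankOne (suc m) k s {V} S small = begin
  2 ^ k * count (allVecs (k + m * k)) (V ∘ tens (suc m) k)
    ≡⟨ cong (2 ^ k *_) (∑-allFunsTo-+ k (m * k) allBools
         (λ a u → bit (V (a ⊗ tens m k u))) (λ {a} a≗a′ u≗u′ → bit-resp (λ i →
           ≈-trans (·-cong (a i) (tens-cong m k u≗u′)) (·-congˡ _ (a≗a′ i))))) ⟩
  2 ^ k * ∑ (allVecs k) hits
    ≡⟨ *-distribˡ-∑ (allVecs k) (2 ^ k) hits ⟩
  ∑ (allVecs k) (λ a → 2 ^ k * hits a)
    ≤⟨ ∑-mono (allVecs k) bound ⟩
  ∑ (allVecs k) (λ a → bit (large B V a) * 2 ^ (k + m * k) + m * 2 ^ (s + m * k))
    ≡⟨ ∑-distrib-+ (allVecs k) _ _ ⟩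
  ∑ (allVecs k) (λ a → bit (large B V a) * 2 ^ (k + m * k))
    + ∑ (allVecs k) (λ _ → m * 2 ^ (s + m * k))
    ≡⟨ cong₂ _+_ (sym (*-distribʳ-∑ (allVecs k) _ _))
                 (trans (∑-const (allVecs k) _) (cong (_* (m * 2 ^ (s + m * k))) (length-allVecs k))) ⟩
  count (allVecs k) (large B V) * 2 ^ (k + m * k) + 2 ^ k * (m * 2 ^ (s + m * k))
    ≤⟨ ℕₚ.+-mono-≤ (ℕₚ.*-monoˡ-≤ (2 ^ (k + m * k)) (few-large-fibres k s S B small′))
                   (ℕₚ.≤-reflexive rearrange) ⟩
  2 ^ s * 2 ^ (k + m * k) + m * 2 ^ (s + (k + m * k))
    ≡⟨ cong (_+ m * 2 ^ (s + (k + m * k))) (sym (ℕₚ.^-distribˡ-+-* 2 s (k + m * k))) ⟩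
  suc m * 2 ^ (s + suc m * k) ∎
  where
  open ≤-Reasoning
  open TensorSpace m k
  open TensorFibres m k
  open TensorSpace.Subspace (suc m) k S using (bit-resp)

  B = 2 ^ (s ^ m)

  hits : (Fin k → Bool) → ℕ
  hits a = count (allVecs (m * k)) (fibre V a ∘ tens m k)

  small′ : count (allTensors (suc m) k) V < B ^ s
  small′ = subst (count (allTensors (suc m) k) V <_)
    (trans (cong (2 ^_) (ℕₚ.*-comm s (s ^ m))) (sym (ℕₚ.^-*-assoc 2 (s ^ m) s))) small

  hits≤ : ∀ a → hits a ≤ 2 ^ (m * k)
  hits≤ a = begin
    hits a                             ≤⟨ ∑-mono (allVecs (m * k)) (λ u → bit-≤1 _) ⟩
    ∑ (allVecs (m * k)) (λ _ → 1)      ≡⟨ length-∑ (allVecs (m * k)) ⟨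
    length (allVecs (m * k))           ≡⟨ length-allVecs (m * k) ⟩
    2 ^ (m * k)                        ∎

  bound : ∀ a → 2 ^ k * hits a ≤ bit (large B V a) * 2 ^ (k + m * k) + m * 2 ^ (s + m * k)
  bound a with large B V a in eq
  -- Large points are few, so all choices of the remaining factors may be conceded to them.
  ... | true  = begin
    2 ^ k * hits a         ≤⟨ ℕₚ.*-monoʳ-≤ (2 ^ k) (hits≤ a) ⟩
    2 ^ k * 2 ^ (m * k)    ≡⟨ ℕₚ.^-distribˡ-+-* 2 k (m * k) ⟨
    2 ^ (k + m * k)        ≡⟨ ℕₚ.+-identityʳ _ ⟨
    1 * 2 ^ (k + m * k)    ≤⟨ ℕₚ.m≤m+n _ _ ⟩
    1 * 2 ^ (k + m * k) + m * 2 ^ (s + m * k) ∎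
  ... | false = few-rankOne m k s (fibre-subspace S a) (ℕₚ.≰⇒> λ B≤ →
    case trans (sym eq) (≤ᵇ-complete B _ B≤) of λ ())

  rearrange : 2 ^ k * (m * 2 ^ (s + m * k)) ≡ m * 2 ^ (s + (k + m * k))
  rearrange = begin-equality
    2 ^ k * (m * 2 ^ (s + m * k))     ≡⟨ ℕₚ.*-comm (2 ^ k) _ ⟩
    m * 2 ^ (s + m * k) * 2 ^ k       ≡⟨ ℕₚ.*-assoc m _ _ ⟩
    m * (2 ^ (s + m * k) * 2 ^ k)     ≡⟨ cong (m *_) (sym (ℕₚ.^-distribˡ-+-* 2 (s + m * k) k)) ⟩
    m * 2 ^ (s + m * k + k)           ≡⟨ cong (λ z → m * 2 ^ z) (ℕₚ.+-assoc s (m * k) k) ⟩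
    m * 2 ^ (s + (m * k + k))         ≡⟨ cong (λ z → m * 2 ^ (s + z)) (ℕₚ.+-comm (m * k) k) ⟩
    m * 2 ^ (s + (k + m * k))         ∎

-- Moments of the correlation sum over a random tensor.

sign-abs : ∀ b → ℤ.∣ sign b ∣ ≡ 1
sign-abs false = refl
sign-abs true  = refl

∣∣-^ : ∀ i n → ℤ.∣ i ℤ.^ n ∣ ≡ ℤ.∣ i ∣ ^ n
∣∣-^ i zero    = refl
∣∣-^ i (suc n) = trans (ℤₚ.abs-* i (i ℤ.^ n)) (cong (ℤ.∣ i ∣ *_) (∣∣-^ i n))

i*i≡∣i∣*∣i∣ : ∀ i → i ℤ.* i ≡ ℤ.+ (ℤ.∣ i ∣ * ℤ.∣ i ∣)
i*i≡∣i∣*∣i∣ (ℤ.+ n)      = sym (ℤₚ.pos-* n n)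
i*i≡∣i∣*∣i∣ (ℤ.-[1+ n ]) = refl

even-^ : ∀ i n → i ℤ.^ (n + n) ≡ ℤ.+ (ℤ.∣ i ∣ ^ (n + n))
even-^ i n = begin
  i ℤ.^ (n + n)                                ≡⟨ ℤₚ.^-distribˡ-+-* i n n ⟩
  i ℤ.^ n ℤ.* i ℤ.^ n                          ≡⟨ i*i≡∣i∣*∣i∣ (i ℤ.^ n) ⟩
  ℤ.+ (ℤ.∣ i ℤ.^ n ∣ * ℤ.∣ i ℤ.^ n ∣)          ≡⟨ cong (λ z → ℤ.+ (z * z)) (∣∣-^ i n) ⟩
  ℤ.+ (ℤ.∣ i ∣ ^ n * ℤ.∣ i ∣ ^ n)              ≡⟨ cong ℤ.+_ (ℕₚ.^-distribˡ-+-* ℤ.∣ i ∣ n n) ⟨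
  ℤ.+ (ℤ.∣ i ∣ ^ (n + n))                      ∎
  where open ≡-Reasoning

module Adjoin {A : Set} {xs : List A} (X : FinSpace A xs) {V : A → Bool}
              (S : FinSpace.Subspace X V) (y : A) where
  open FinSpace X
  open Subspace S

  V⊕ : A → Bool
  V⊕ v = V v ∨ V (v ⊕ y)

  ∨-elim : ∀ {a b} → a ∨ b ≡ true → (a ≡ true) ⊎ (b ≡ true)
  ∨-elim {true}  eq = inj₁ refl
  ∨-elim {false} eq = inj₂ eq

  introʳ : ∀ {v} → V (v ⊕ y) ≡ true → V⊕ v ≡ true
  introʳ v∈ = trans (cong (V _ ∨_) v∈) (Boolₚ.∨-zeroʳ _)

  introˡ : ∀ {v} → V v ≡ true → V⊕ v ≡ true
  introˡ v∈ = cong (_∨ V _) v∈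

  V⊕-subspace : Subspace V⊕
  V⊕-subspace = record
    { respects = λ v≈w → cong₂ _∨_ (respects v≈w) (respects (⊕-cong v≈w ≈-refl))
    ; zero∈ = introˡ zero∈
    ; ⊕∈ = sum
    }
    where
    swapʳ : ∀ v w → (v ⊕ y) ⊕ w ≈ (v ⊕ w) ⊕ y
    swapʳ v w = ≈-trans (⊕-assoc v y w) (≈-trans (⊕-cong ≈-refl (⊕-comm y w)) (≈-sym (⊕-assoc v w y)))

    sum : ∀ {v w} → V⊕ v ≡ true → V⊕ w ≡ true → V⊕ (v ⊕ w) ≡ true
    sum {v} {w} v∈ w∈ with ∨-elim {V v} v∈ | ∨-elim {V w} w∈
    ... | inj₁ v∈ | inj₁ w∈ = introˡ (⊕∈ v∈ w∈)
    ... | inj₁ v∈ | inj₂ w∈ = introʳ (≈∈ (≈-sym (⊕-assoc v w y)) (⊕∈ v∈ w∈))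
    ... | inj₂ v∈ | inj₁ w∈ = introʳ (≈∈ (swapʳ v w) (⊕∈ v∈ w∈))
    ... | inj₂ v∈ | inj₂ w∈ = introˡ (≈∈ (≈-trans (⊕-medial v y w y)
                                (≈-trans (⊕-cong ≈-refl (⊕-self y)) (⊕-identityʳ _))) (⊕∈ v∈ w∈))

  bit-∨ : ∀ a b → bit (a ∨ b) ≤ bit a + bit b
  bit-∨ false b = ℕₚ.≤-refl
  bit-∨ true  b = ℕₚ.m≤m+n 1 (bit b)

  count-V⊕ : count xs V⊕ ≤ 2 * count xs V
  count-V⊕ = begin
    count xs V⊕                                    ≤⟨ ∑-mono xs (λ v → bit-∨ (V v) _) ⟩
    ∑ xs (λ v → bit (V v) + bit (V (v ⊕ y)))       ≡⟨ ∑-distrib-+ xs _ _ ⟩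
    count xs V + count xs (λ v → V (v ⊕ y))        ≡⟨ cong (count xs V +_) (∑-shift _ bit-resp y) ⟩
    count xs V + count xs V                        ≡⟨ cong (count xs V +_) (ℕₚ.+-identityʳ _) ⟨
    2 * count xs V                                 ∎
    where open ≤-Reasoning

  -- Translation by an element of `V` preserves `V`.
  translate-∈ : V y ≡ true → ∀ v → bit (V v) + bit (V (v ⊕ y)) ≡ 2 * bit (V v)
  translate-∈ y∈ v with V v in eq
  ... | true  = cong (λ z → 1 + bit z) (⊕∈ eq y∈)
  ... | false with V (v ⊕ y) in eq′
  ...   | false = refl
  ...   | true  with () ← trans (sym eq) (≈∈ (⊕-cancelʳ v y) (⊕∈ eq′ y∈))

  -- `V` and its translate by `y` are disjoint cosets, so no element is counted twice.
  translate-∉ : V y ≡ false → ∀ v → bit (V v) + bit (V (v ⊕ y)) ≡ bit (V⊕ v)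
  translate-∉ y∉ v with V v in eq
  ... | false = refl
  ... | true  with V (v ⊕ y) in eq′
  ...   | false = refl
  ...   | true  with () ← trans (sym y∉) (≈∈ (≈-trans (⊕-cong (⊕-comm v y) ≈-refl) (⊕-cancelʳ y v))
                                              (⊕∈ eq′ eq))

module Moments (m k : ℕ) where
  private
    module D = TensorSpace (suc m) k
    module G = TensorSpace m k
    xs = allVecs (suc m * k)
    us = allVecs (m * k)
    Ts = allTensors (suc m) k
    t⃗ = tens (suc m) k
    u⃗ = tens m k

  spread : (Tensor (suc m) k → ℕ) → Tensor (suc m) k → ℕ
  spread F R = ∑ xs (λ x → F (R D.⊕ t⃗ x))

  -- Sums `F` at `R` plus the rank-one tensors of t points, over all t-tuples. With `F` the
  -- indicator of zero and `R` zero it counts the zero-sum tuples.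
  spread^ : ℕ → (Tensor (suc m) k → ℕ) → Tensor (suc m) k → ℕ
  spread^ zero    F = F
  spread^ (suc t) F = spread (spread^ t F)

  spread^-cong : ∀ t {F H} → (∀ R → F R ≡ H R) → ∀ R → spread^ t F R ≡ spread^ t H R
  spread^-cong zero    eq = eq
  spread^-cong (suc t) eq R = ∑-cong xs (λ x → spread^-cong t eq (R D.⊕ t⃗ x))

  -- The definition moves the starting tensor, whereas the bound below keeps it at zero and
  -- transforms the function; this exchanges the two.
  spread^-suc : ∀ t F R → spread^ (suc t) F R ≡ spread^ t (spread F) R
  spread^-suc zero    F R = refl
  spread^-suc (suc t) F R = ∑-cong xs (λ x → spread^-suc t F (R D.⊕ t⃗ x))

  spread^-∑ : ∀ {B : Set} t (ys : List B) (F : B → Tensor (suc m) k → ℕ) R →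
              spread^ t (λ R → ∑ ys (λ y → F y R)) R ≡ ∑ ys (λ y → spread^ t (F y) R)
  spread^-∑ zero    ys F R = refl
  spread^-∑ (suc t) ys F R =
    trans (∑-cong xs (λ x → spread^-∑ t ys F (R D.⊕ t⃗ x))) (∑-swap xs ys _)

  spread^-* : ∀ t c F R → spread^ t (λ R → c * F R) R ≡ c * spread^ t F R
  spread^-* zero    c F R = refl
  spread^-* (suc t) c F R =
    trans (∑-cong xs (λ x → spread^-* t c F (R D.⊕ t⃗ x))) (sym (*-distribˡ-∑ xs c _))

  slicewise : (Tensor m k → ℕ) → Tensor (suc m) k → ℕ
  slicewise c R = ∏ k (λ i → c (R i))

  slicewise-cong : ∀ {c c′} → (∀ v → c v ≡ c′ v) → ∀ R → slicewise c R ≡ slicewise c′ R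
  slicewise-cong eq R = ∏-cong k (λ i → eq (R i))

  -- Write the rank-one tensor as a ⊗ `u⃗ u`. Bit i of a alone decides whether `u⃗ u` is added to
  -- slice i, so for fixed `u` the sum over a factors and leaves a slicewise function again.
  spread-slicewise : ∀ c → G.Respects c → ∀ R →
    spread (slicewise c) R ≡ ∑ us (λ u → slicewise (λ v → c v + c (v G.⊕ u⃗ u)) R)
  spread-slicewise c c-resp R = begin
    spread (slicewise c) R
      ≡⟨ ∑-allFunsTo-+ k (m * k) allBools (λ a u → ∏ k (λ i → c (R i G.⊕ a i G.· u⃗ u)))
           (λ {a} a≗a′ u≗u′ → ∏-cong k (λ i → c-resp (G.⊕-cong G.≈-refl
             (G.≈-trans (G.·-cong (a i) (tens-cong m k u≗u′)) (G.·-congˡ _ (a≗a′ i)))))) ⟩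
    ∑ (allVecs k) (λ a → ∑ us (λ u → ∏ k (λ i → c (R i G.⊕ a i G.· u⃗ u))))
      ≡⟨ ∑-swap (allVecs k) us _ ⟩
    ∑ us (λ u → ∑ (allVecs k) (λ a → ∏ k (λ i → c (R i G.⊕ a i G.· u⃗ u))))
      ≡⟨ ∑-cong us (λ u → ∑-∏ k allBools (λ i b → c (R i G.⊕ b G.· u⃗ u))) ⟩
    ∑ us (λ u → ∏ k (λ i → c (R i G.⊕ G.𝟘) + (c (R i G.⊕ u⃗ u) + 0)))
      ≡⟨ ∑-cong us (λ u → ∏-cong k (λ i →
           cong₂ _+_ (c-resp (G.⊕-identityʳ (R i))) (ℕₚ.+-identityʳ _))) ⟩
    ∑ us (λ u → slicewise (λ v → c v + c (v G.⊕ u⃗ u)) R) ∎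
    where open ≡-Reasoning

  -- Bound per point of a tuple: the trivial value 2^((m+1)k) times (m+1) 2^(s - k).
  rate : ℕ → ℕ
  rate s = 2 ^ (m * k) * (suc m * 2 ^ s)

  -- `V` is the span of the order-m tensors seen so far, and `Z` is 2 to the number of those that
  -- fell into the span of their predecessors. A tensor outside `V` enlarges the span; one inside
  -- doubles `Z`, which costs 2^k in the result but is rare by `few-rankOne`. Thus the rank weight
  -- is never computed from a rank. The hypothesis `r + t ≤ s ^ m` reserves one dimension for each
  -- remaining point.
  spread^-bound : ∀ s t r Z {V} → G.Subspace V → count (allTensors m k) V ≤ 2 ^ r → r + t ≤ s ^ m →
                  spread^ t (slicewise (λ v → Z * bit (V v))) D.𝟘 ≤ Z ^ k * rate s ^ t
  spread^-bound s zero r Z {V} S V≤ r≤ = ℕₚ.≤-reflexive (begin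
    ∏ k (λ _ → Z * bit (V G.𝟘))   ≡⟨ ∏-const k _ ⟩
    (Z * bit (V G.𝟘)) ^ k         ≡⟨ cong (λ b → (Z * bit b) ^ k) (G.Subspace.zero∈ S) ⟩
    (Z * 1) ^ k                   ≡⟨ cong (_^ k) (ℕₚ.*-identityʳ Z) ⟩
    Z ^ k                         ≡⟨ ℕₚ.*-identityʳ _ ⟨
    Z ^ k * 1                     ∎)
    where open ≡-Reasoning
  spread^-bound s (suc t) r Z {V} S V≤ r≤ = begin
    spread^ (suc t) (slicewise c) D.𝟘
      ≡⟨ spread^-suc t (slicewise c) D.𝟘 ⟩
    spread^ t (spread (slicewise c)) D.𝟘
      ≡⟨ spread^-cong t (spread-slicewise c (λ eq → cong (Z *_) (bit-resp eq))) D.𝟘 ⟩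
    spread^ t (λ R → ∑ us (λ u → slicewise (c⊕ u) R)) D.𝟘
      ≡⟨ spread^-∑ t us (λ u → slicewise (c⊕ u)) D.𝟘 ⟩
    ∑ us (λ u → spread^ t (slicewise (c⊕ u)) D.𝟘)
      ≤⟨ ∑-mono us bound ⟩
    ∑ us (λ u → (1 + 2 ^ k * bit (V (u⃗ u))) * E)
      ≡⟨ *-distribʳ-∑ us E _ ⟨
    ∑ us (λ u → 1 + 2 ^ k * bit (V (u⃗ u))) * E
      ≡⟨ cong (_* E) (trans (∑-distrib-+ us _ _) (cong₂ _+_
           (trans (sym (length-∑ us)) (length-allVecs (m * k))) (sym (*-distribˡ-∑ us (2 ^ k) _)))) ⟩
    (2 ^ (m * k) + 2 ^ k * count us (V ∘ u⃗)) * E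
      ≤⟨ ℕₚ.*-monoˡ-≤ E (ℕₚ.+-monoʳ-≤ (2 ^ (m * k)) (few-rankOne m k s S V<)) ⟩
    -- The summand 1 paid by every `u` totals 2^(mk) and is rounded up to 2^(s + mk); hence the
    -- factor m + 1 in `rate`.
    (2 ^ (m * k) + m * 2 ^ (s + m * k)) * E
      ≤⟨ ℕₚ.*-monoˡ-≤ E (ℕₚ.+-monoˡ-≤ (m * 2 ^ (s + m * k)) (ℕₚ.^-monoʳ-≤ 2 (ℕₚ.m≤n+m (m * k) s))) ⟩
    suc m * 2 ^ (s + m * k) * E
      ≡⟨ cong (_* E) rate≡ ⟩
    rate s * (Z ^ k * rate s ^ t)
      ≡⟨ ℕₚ.*-comm (rate s) _ ⟩
    Z ^ k * rate s ^ t * rate s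
      ≡⟨ ℕₚ.*-assoc (Z ^ k) _ _ ⟩
    Z ^ k * (rate s ^ t * rate s)
      ≡⟨ cong (Z ^ k *_) (ℕₚ.*-comm _ (rate s)) ⟩
    Z ^ k * rate s ^ suc t ∎
    where
    open ≤-Reasoning
    open G.Subspace S
    E = Z ^ k * rate s ^ t

    c : Tensor m k → ℕ
    c v = Z * bit (V v)

    c⊕ : (Fin (m * k) → Bool) → Tensor m k → ℕ
    c⊕ u v = c v + c (v G.⊕ u⃗ u)

    r+1+t≤ : suc r + t ≤ s ^ m
    r+1+t≤ = subst (_≤ s ^ m) (ℕₚ.+-suc r t) r≤

    V< : count (allTensors m k) V < 2 ^ (s ^ m)
    V< = ℕₚ.≤-<-trans V≤ (ℕₚ.^-monoʳ-< 2 (s≤s (s≤s z≤n)) (ℕₚ.m+n≤o⇒m≤o (suc r) r+1+t≤))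

    rate≡ : suc m * 2 ^ (s + m * k) ≡ rate s
    rate≡ = begin-equality
      suc m * 2 ^ (s + m * k)            ≡⟨ cong (suc m *_) (ℕₚ.^-distribˡ-+-* 2 s (m * k)) ⟩
      suc m * (2 ^ s * 2 ^ (m * k))      ≡⟨ ℕₚ.*-assoc (suc m) (2 ^ s) (2 ^ (m * k)) ⟨
      suc m * 2 ^ s * 2 ^ (m * k)        ≡⟨ ℕₚ.*-comm (suc m * 2 ^ s) (2 ^ (m * k)) ⟩
      rate s                             ∎

    c⊕≡ : ∀ u v → c⊕ u v ≡ Z * (bit (V v) + bit (V (v G.⊕ u⃗ u)))
    c⊕≡ u v = sym (ℕₚ.*-distribˡ-+ Z _ _)

    bound : ∀ u → spread^ t (slicewise (c⊕ u)) D.𝟘 ≤ (1 + 2 ^ k * bit (V (u⃗ u))) * E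
    bound u with V (u⃗ u) in eq
    ... | true  = begin
      spread^ t (slicewise (c⊕ u)) D.𝟘
        ≡⟨ spread^-cong t (slicewise-cong (λ v → trans (c⊕≡ u v) (trans
             (cong (Z *_) (translate-∈ eq v)) (trans (sym (ℕₚ.*-assoc Z 2 _)) (cong (_* bit (V v)) (ℕₚ.*-comm Z 2)))))) D.𝟘 ⟩
      spread^ t (slicewise (λ v → 2 * Z * bit (V v))) D.𝟘
        ≤⟨ spread^-bound s t r (2 * Z) S V≤ (ℕₚ.≤-trans (ℕₚ.n≤1+n _) r+1+t≤) ⟩
      (2 * Z) ^ k * rate s ^ t
        ≡⟨ cong (_* rate s ^ t) (^-distribʳ-* k 2 Z) ⟩
      2 ^ k * Z ^ k * rate s ^ t
        ≡⟨ ℕₚ.*-assoc (2 ^ k) _ _ ⟩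
      2 ^ k * E
        ≤⟨ ℕₚ.*-monoˡ-≤ E (ℕₚ.n≤1+n (2 ^ k)) ⟩
      (1 + 2 ^ k) * E
        ≡⟨ cong (λ z → (1 + z) * E) (ℕₚ.*-identityʳ (2 ^ k)) ⟨
      (1 + 2 ^ k * 1) * E ∎
      where open Adjoin (tensorSpace m k) S (u⃗ u)
    ... | false = begin
      spread^ t (slicewise (c⊕ u)) D.𝟘
        ≡⟨ spread^-cong t (slicewise-cong (λ v → trans (c⊕≡ u v) (cong (Z *_) (translate-∉ eq v)))) D.𝟘 ⟩
      spread^ t (slicewise (λ v → Z * bit (V⊕ v))) D.𝟘
        ≤⟨ spread^-bound s t (suc r) Z V⊕-subspace
             (ℕₚ.≤-trans count-V⊕ (ℕₚ.*-monoʳ-≤ 2 V≤)) r+1+t≤ ⟩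
      E
        ≡⟨ ℕₚ.*-identityˡ E ⟨
      1 * E
        ≡⟨ cong (λ z → (1 + z) * E) (ℕₚ.*-zeroʳ (2 ^ k)) ⟨
      (1 + 2 ^ k * 0) * E ∎
      where open Adjoin (tensorSpace m k) S (u⃗ u)

  χ : Tensor (suc m) k → Tensor (suc m) k → ℤ
  χ T R = sign (⟨_,_⟩ {suc m} {k} T R)

  χ-⊕ : ∀ T R R′ → χ T (R D.⊕ R′) ≡ χ T R ℤ.* χ T R′
  χ-⊕ T R R′ = trans (cong sign (⟨⟩-⊕ʳ (suc m) k T R R′))
                       (sign-xor (⟨_,_⟩ {suc m} {k} T R) (⟨_,_⟩ {suc m} {k} T R′))

  twistedSum : ((Fin (suc m * k) → Bool) → Bool) → Tensor (suc m) k → ℤ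
  twistedSum g T = ℤ∑.∑ xs (λ x → sign (g x) ℤ.* χ T (t⃗ x))

  signSum-twistedSum : ∀ g T →
    signSum (suc m * k) (λ x → formOnFlat {suc m} {k} T x xor g x) ≡ twistedSum g T
  signSum-twistedSum g T = ℤ∑.∑-cong xs λ x → trans (sign-xor (formOnFlat {suc m} {k} T x) (g x)) (trans
    (ℤₚ.*-comm _ (sign (g x)))
    (cong (λ b → sign (g x) ℤ.* sign b) (multilinearForm-⟨⟩ (suc m) k T (λ j i → x (combine j i)))))

  -- Averaging over T leaves only the tuples of points whose rank-one tensors sum to R, and there
  -- the twist by g has absolute value one.
  twisted-moment : ∀ g t R →
    ℤ.∣ ℤ∑.∑ Ts (λ T → χ T R ℤ.* twistedSum g T ℤ.^ t) ∣
      ≤ spread^ t (λ R → length Ts * bit (vanishes (suc m) k R)) R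
  twisted-moment g zero R = ℕₚ.≤-reflexive (cong ℤ.∣_∣
    (trans (ℤ∑.∑-cong Ts (λ T → ℤₚ.*-identityʳ (χ T R))) (∑-character (suc m) k R)))
  twisted-moment g (suc t) R = begin
    ℤ.∣ ℤ∑.∑ Ts (λ T → χ T R ℤ.* (twistedSum g T ℤ.* twistedSum g T ℤ.^ t)) ∣
      ≡⟨ cong ℤ.∣_∣ expand ⟩
    ℤ.∣ ℤ∑.∑ xs (λ x → sign (g x) ℤ.* moment (R D.⊕ t⃗ x)) ∣
      ≤⟨ ∣∑∣≤∑∣∣ xs _ ⟩
    ∑ xs (λ x → ℤ.∣ sign (g x) ℤ.* moment (R D.⊕ t⃗ x) ∣)
      ≡⟨ ∑-cong xs (λ x → trans (ℤₚ.abs-* (sign (g x)) _)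
           (trans (cong (_* ℤ.∣ moment (R D.⊕ t⃗ x) ∣) (sign-abs (g x))) (ℕₚ.*-identityˡ _))) ⟩
    ∑ xs (λ x → ℤ.∣ moment (R D.⊕ t⃗ x) ∣)
      ≤⟨ ∑-mono xs (λ x → twisted-moment g t (R D.⊕ t⃗ x)) ⟩
    spread^ (suc t) (λ R → length Ts * bit (vanishes (suc m) k R)) R ∎
    where
    open ≤-Reasoning

    -- The character at `R` records the tensors already absorbed: each step expands one factor of
    -- the power and moves its character into `R`.
    moment : Tensor (suc m) k → ℤ
    moment R = ℤ∑.∑ Ts (λ T → χ T R ℤ.* twistedSum g T ℤ.^ t)

    regroup : ∀ c s c′ p → c ℤ.* ((s ℤ.* c′) ℤ.* p) ≡ s ℤ.* ((c ℤ.* c′) ℤ.* p)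
    regroup = ℤ-solve-∀

    term : ∀ T → χ T R ℤ.* (twistedSum g T ℤ.* twistedSum g T ℤ.^ t)
               ≡ ℤ∑.∑ xs (λ x → sign (g x) ℤ.* (χ T (R D.⊕ t⃗ x) ℤ.* twistedSum g T ℤ.^ t))
    term T = let P = twistedSum g T ℤ.^ t in
      trans (cong (ℤ._*_ (χ T R)) (ℤ∑.*-distribʳ-∑ xs P _))
        (trans (ℤ∑.*-distribˡ-∑ xs (χ T R) _)
          (ℤ∑.∑-cong xs (λ x → trans (regroup (χ T R) (sign (g x)) (χ T (t⃗ x)) P)
            (cong (λ z → sign (g x) ℤ.* (z ℤ.* P)) (sym (χ-⊕ T R (t⃗ x)))))))

    expand : ℤ∑.∑ Ts (λ T → χ T R ℤ.* (twistedSum g T ℤ.* twistedSum g T ℤ.^ t))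
           ≡ ℤ∑.∑ xs (λ x → sign (g x) ℤ.* moment (R D.⊕ t⃗ x))
    expand = trans (ℤ∑.∑-cong Ts term) (trans (ℤ∑.∑-swap Ts xs _)
      (ℤ∑.∑-cong xs (λ x → sym (ℤ∑.*-distribˡ-∑ Ts (sign (g x)) _))))

  -- An even exponent removes the absolute value from the correlation sum, so its power can be
  -- expanded into characters.
  even-moment : ∀ g s h → h + h ≤ s ^ m →
    ∑ Ts (λ T → corrNum (suc m * k) (formOnFlat {suc m} {k} T) g ^ (h + h))
      ≤ length Ts * rate s ^ (h + h)
  even-moment g s h 2h≤ = begin
    ∑ Ts (λ T → corrNum (suc m * k) (formOnFlat {suc m} {k} T) g ^ t)
      ≡⟨ ∑-cong Ts (λ T → cong (λ z → ℤ.∣ z ∣ ^ t) (signSum-twistedSum g T)) ⟩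
    ∑ Ts (λ T → ℤ.∣ twistedSum g T ∣ ^ t)
      ≡⟨ cong ℤ.∣_∣ (trans (sym (∑-+ Ts _)) (ℤ∑.∑-cong Ts (λ T → trans (sym (even-^ (twistedSum g T) h))
           (trans (sym (ℤₚ.*-identityˡ _))
             (cong (λ b → sign b ℤ.* twistedSum g T ℤ.^ t) (sym (⟨⟩-zeroʳ (suc m) k T))))))) ⟩
    ℤ.∣ ℤ∑.∑ Ts (λ T → χ T D.𝟘 ℤ.* twistedSum g T ℤ.^ t) ∣
      ≤⟨ twisted-moment g t D.𝟘 ⟩
    spread^ t (λ R → length Ts * bit (vanishes (suc m) k R)) D.𝟘
      ≡⟨ spread^-* t (length Ts) _ D.𝟘 ⟩
    length Ts * spread^ t (λ R → bit (vanishes (suc m) k R)) D.𝟘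
      ≡⟨ cong (length Ts *_) (spread^-cong t (λ R → trans (bit-andFin k _)
           (∏-cong k (λ i → sym (ℕₚ.*-identityˡ _)))) D.𝟘) ⟩
    length Ts * spread^ t (slicewise (λ v → 1 * bit (vanishes m k v))) D.𝟘
      ≤⟨ ℕₚ.*-monoʳ-≤ (length Ts) (spread^-bound s t 0 1 (vanishes-subspace m k)
           (ℕₚ.≤-reflexive (count-vanishes m k)) 2h≤) ⟩
    length Ts * (1 ^ k * rate s ^ t)
      ≡⟨ cong (λ z → length Ts * (z * rate s ^ t)) (ℕₚ.^-zeroˡ k) ⟩
    length Ts * (1 * rate s ^ t)
      ≡⟨ cong (length Ts *_) (ℕₚ.*-identityˡ _) ⟩
    length Ts * rate s ^ t ∎
    where open ≤-Reasoning
          t = h + h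

rate-pos : ∀ m k s → 1 ≤ Moments.rate m k s
rate-pos m k s = ℕₚ.*-mono-≤ {1} {_} {1} (ℕₚ.m^n>0 2 (m * k))
                   (ℕₚ.*-mono-≤ {1} {suc m} {1} (s≤s z≤n) (ℕₚ.m^n>0 2 s))

-- By symmetry of the pairing, points can be summed like tensors of order one, so the sum vanishes
-- unless T = 0. The resulting average 1 is relaxed to `rate` to match the shape of the higher
-- orders.
linear-moment : ∀ k s {g b} → (∀ x → g x ≡ b) →
  ∑ (allTensors 1 k) (λ T → corrNum (1 * k) (formOnFlat {1} {k} T) g)
    ≤ length (allTensors 1 k) * Moments.rate 0 k s
linear-moment k s {g} {b} g≡b = begin
  ∑ Ts (λ T → corrNum (1 * k) (formOnFlat {1} {k} T) g)
    ≡⟨ ∑-cong Ts (λ T → trans (cong ℤ.∣_∣ (signSum-twistedSum g T)) (∣twistedSum∣ T)) ⟩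
  ∑ Ts (λ T → L * bit (vanishes 1 k T))
    ≡⟨ *-distribˡ-∑ Ts L _ ⟨
  L * count Ts (vanishes 1 k)
    ≡⟨ cong (L *_) (count-vanishes 1 k) ⟩
  L * 1
    ≤⟨ ℕₚ.*-monoʳ-≤ L (rate-pos 0 k s) ⟩
  L * Moments.rate 0 k s ∎
  where
  open ≤-Reasoning
  open Moments 0 k
  open TensorSpace 0 k
  Ts = allTensors 1 k
  L = length Ts

  ·-true : ∀ c → c · true ≡ c
  ·-true false = refl
  ·-true true  = refl

  ∑χ : ∀ T → ℤ∑.∑ (allVecs (1 * k)) (λ x → χ T (tens 1 k x)) ≡ ℤ.+ (L * bit (vanishes 1 k T))
  ∑χ T = trans
    (ℤ∑.∑-allFunsTo-+ k 0 allBools (λ a _ → χ T (λ i → a i · true)) (λ a≗a′ _ →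
      cong sign (⟨⟩-congʳ 1 k T (λ i → cong (_· true) (a≗a′ i)))))
    (trans (ℤ∑.∑-cong (allVecs k) (λ a → trans (ℤₚ.+-identityʳ _) (cong sign
      (trans (⟨⟩-congʳ 1 k T (λ i → ·-true (a i))) (⟨⟩-comm 1 k T a)))))
      (∑-character 1 k T))

  ∣twistedSum∣ : ∀ T → ℤ.∣ twistedSum g T ∣ ≡ L * bit (vanishes 1 k T)
  ∣twistedSum∣ T = begin-equality
    ℤ.∣ twistedSum g T ∣
      ≡⟨ cong ℤ.∣_∣ (ℤ∑.∑-cong (allVecs (1 * k)) (λ x → cong (λ c → sign c ℤ.* χ T (tens 1 k x)) (g≡b x))) ⟩
    ℤ.∣ ℤ∑.∑ (allVecs (1 * k)) (λ x → sign b ℤ.* χ T (tens 1 k x)) ∣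
      ≡⟨ cong ℤ.∣_∣ (ℤ∑.*-distribˡ-∑ (allVecs (1 * k)) (sign b) _) ⟨
    ℤ.∣ sign b ℤ.* ℤ∑.∑ (allVecs (1 * k)) (λ x → χ T (tens 1 k x)) ∣
      ≡⟨ cong (λ z → ℤ.∣ sign b ℤ.* z ∣) (∑χ T) ⟩
    ℤ.∣ sign b ℤ.* ℤ.+ (L * bit (vanishes 1 k T)) ∣
      ≡⟨ ℤₚ.abs-* (sign b) _ ⟩
    ℤ.∣ sign b ∣ * (L * bit (vanishes 1 k T))
      ≡⟨ cong (_* (L * bit (vanishes 1 k T))) (sign-abs b) ⟩
    1 * (L * bit (vanishes 1 k T))
      ≡⟨ ℕₚ.*-identityˡ _ ⟩
    L * bit (vanishes 1 k T) ∎

-- Writing s = q + q makes s^m the double of q s^(m-1) when m ≥ 1, so `even-moment` applies; m = 0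
-- is the linear case.
moment : ∀ m k q g → (m ≡ 0 → ∃ λ b → ∀ x → g x ≡ b) →
  ∑ (allTensors (suc m) k) (λ T → corrNum (suc m * k) (formOnFlat {suc m} {k} T) g ^ ((q + q) ^ m))
    ≤ length (allTensors (suc m) k) * Moments.rate m k (q + q) ^ ((q + q) ^ m)
moment zero k q g const = begin
  ∑ Ts (λ T → corrNum (1 * k) (formOnFlat {1} {k} T) g ^ 1)
    ≡⟨ ∑-cong Ts (λ T → ℕₚ.*-identityʳ _) ⟩
  ∑ Ts (λ T → corrNum (1 * k) (formOnFlat {1} {k} T) g)
    ≤⟨ linear-moment k (q + q) (proj₂ (const refl)) ⟩
  length Ts * Moments.rate 0 k (q + q)
    ≡⟨ cong (length Ts *_) (ℕₚ.*-identityʳ _) ⟨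
  length Ts * Moments.rate 0 k (q + q) ^ 1 ∎
  where open ≤-Reasoning
        Ts = allTensors 1 k
moment (suc m) k q g const =
  subst (λ t → ∑ Ts (λ T → corrNum (suc (suc m) * k) (formOnFlat {suc (suc m)} {k} T) g ^ t)
                 ≤ length Ts * Moments.rate (suc m) k (q + q) ^ t)
        t≡ (Moments.even-moment (suc m) k g (q + q) (q * (q + q) ^ m) (ℕₚ.≤-reflexive t≡))
  where
  Ts = allTensors (suc (suc m)) k
  t≡ : q * (q + q) ^ m + q * (q + q) ^ m ≡ (q + q) ^ suc m
  t≡ = sym (ℕₚ.*-distribʳ-+ ((q + q) ^ m) q q)

-- Counting the functions of low degree.

numMonomials : ℕ → ℕ → ℕ
numMonomials zero    ℓ       = 1
numMonomials (suc N) zero    = numMonomials N zero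
-- Pascal's rule for the sum of C(N,i) over i ≤ ℓ. Only squarefree monomials are counted, since x² =
-- x as a function on F₂.
numMonomials (suc N) (suc ℓ) = numMonomials N (suc ℓ) + numMonomials N ℓ

-- The coefficients of g₀ + x₀ g₁ are those of g₀, of degree at most ℓ, followed by those of g₁.
evalCoeffs : ∀ N ℓ → (Fin (numMonomials N ℓ) → Bool) → (Fin N → Bool) → Bool
evalCoeffs zero    ℓ       c x = c zero
evalCoeffs (suc N) zero    c x = evalCoeffs N zero c (x ∘ suc)
evalCoeffs (suc N) (suc ℓ) c x =
  evalCoeffs N (suc ℓ) (c ∘ (_↑ˡ numMonomials N ℓ)) (x ∘ suc)
    xor (x zero ∧ evalCoeffs N ℓ (c ∘ (numMonomials N (suc ℓ) ↑ʳ_)) (x ∘ suc))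

evalCoeffs-cong : ∀ N ℓ {c c′} → (∀ i → c i ≡ c′ i) → ∀ x → evalCoeffs N ℓ c x ≡ evalCoeffs N ℓ c′ x
evalCoeffs-cong zero    ℓ       eq x = eq zero
evalCoeffs-cong (suc N) zero    eq x = evalCoeffs-cong N zero eq (x ∘ suc)
evalCoeffs-cong (suc N) (suc ℓ) eq x = cong₂ _xor_ (evalCoeffs-cong N (suc ℓ) (λ i → eq (i ↑ˡ _)) (x ∘ suc))
  (cong (x zero ∧_) (evalCoeffs-cong N ℓ (λ i → eq (numMonomials N (suc ℓ) ↑ʳ i)) (x ∘ suc)))

evalCoeffs-false : ∀ N ℓ x → evalCoeffs N ℓ (λ _ → false) x ≡ false
evalCoeffs-false zero    ℓ       x = refl
evalCoeffs-false (suc N) zero    x = evalCoeffs-false N zero (x ∘ suc)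
evalCoeffs-false (suc N) (suc ℓ) x = cong₂ _xor_ (evalCoeffs-false N (suc ℓ) (x ∘ suc))
  (trans (cong (x zero ∧_) (evalCoeffs-false N ℓ (x ∘ suc))) (Boolₚ.∧-zeroʳ (x zero)))

evalCoeffs-xor : ∀ N ℓ c c′ x →
  evalCoeffs N ℓ (λ i → c i xor c′ i) x ≡ evalCoeffs N ℓ c x xor evalCoeffs N ℓ c′ x
evalCoeffs-xor zero    ℓ       c c′ x = refl
evalCoeffs-xor (suc N) zero    c c′ x = evalCoeffs-xor N zero c c′ (x ∘ suc)
evalCoeffs-xor (suc N) (suc ℓ) c c′ x = trans
  (cong₂ _xor_ (evalCoeffs-xor N (suc ℓ) _ _ (x ∘ suc))
    (trans (cong (x zero ∧_) (evalCoeffs-xor N ℓ _ _ (x ∘ suc))) (Boolₚ.∧-distribˡ-xor (x zero) _ _)))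
  (𝔹∑.medial (evalCoeffs N (suc ℓ) _ (x ∘ suc)) _ _ _)

evalCoeffs-degree-zero : ∀ N c → ∃ λ b → ∀ x → evalCoeffs N 0 c x ≡ b
evalCoeffs-degree-zero zero    c = c zero , λ _ → refl
evalCoeffs-degree-zero (suc N) c =
  let b , eq = evalCoeffs-degree-zero N c in b , λ x → eq (x ∘ suc)

Represented : ∀ N → ℕ → ((Fin N → Bool) → Bool) → Set
Represented N ℓ f = ∃ λ c → ∀ x → evalCoeffs N ℓ c x ≡ f x

∧-powB : ∀ b e → b ∧ powB b e ≡ b
∧-powB false e       = refl
∧-powB true  zero    = refl
∧-powB true  (suc e) = ∧-powB true e

represent-lift : ∀ N ℓ {f} → Represented N ℓ f → Represented (suc N) ℓ (f ∘ (_∘ suc))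
represent-lift N zero    (c , c≡f) = c , λ x → c≡f (x ∘ suc)
represent-lift N (suc ℓ) {f} (c , c≡f) = (c VF.++ λ _ → false) , λ x → trans
  (cong₂ _xor_
    (trans (evalCoeffs-cong N (suc ℓ) (VFₚ.lookup-++ˡ c _) (x ∘ suc)) (c≡f (x ∘ suc)))
    (trans (cong (x zero ∧_) (trans (evalCoeffs-cong N ℓ (VFₚ.lookup-++ʳ c _) (x ∘ suc))
      (evalCoeffs-false N ℓ (x ∘ suc)))) (Boolₚ.∧-zeroʳ (x zero))))
  (xor-identityʳ _)

represent-times : ∀ N ℓ {f} → Represented N ℓ f →
                  Represented (suc N) (suc ℓ) (λ x → x zero ∧ f (x ∘ suc))
represent-times N ℓ (c , c≡f) = (zeros VF.++ c) , λ x → cong₂ _xor_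
  (trans (evalCoeffs-cong N (suc ℓ) (VFₚ.lookup-++ˡ zeros c) (x ∘ suc)) (evalCoeffs-false N (suc ℓ) (x ∘ suc)))
  (cong (x zero ∧_) (trans (evalCoeffs-cong N ℓ (VFₚ.lookup-++ʳ zeros c) (x ∘ suc)) (c≡f (x ∘ suc))))
  where zeros : Fin (numMonomials N (suc ℓ)) → Bool
        zeros _ = false

represent-monomial : ∀ N ℓ (e : Monomial N) → monoDeg e ≤ ℓ → Represented N ℓ (evalMono e)
represent-monomial zero    ℓ e deg≤ = (λ _ → true) , λ _ → refl
represent-monomial (suc N) ℓ e deg≤ with e zero
represent-monomial (suc N) ℓ e deg≤ | zero = represent-lift N ℓ (represent-monomial N ℓ (e ∘ suc) deg≤)
-- As a function the power p + 1 of x₀ is x₀, so it uses one degree and the surplus p is dropped.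
represent-monomial (suc N) (suc ℓ) e (s≤s deg≤) | suc p =
  let c , eq = represent-times N ℓ (represent-monomial N ℓ (e ∘ suc) (ℕₚ.≤-trans (ℕₚ.m≤n+m _ p) deg≤))
  in c , λ x → trans (eq x) (cong (_∧ _) (sym (∧-powB (x zero) p)))

represent-polynomial : ∀ N ℓ (P : Poly N) → DegAtMost ℓ P → Represented N ℓ (evalPoly P)
represent-polynomial N ℓ []      []           = (λ _ → false) , evalCoeffs-false N ℓ
represent-polynomial N ℓ (e ∷ P) (e≤ ∷ P≤) =
  let c , c≡e = represent-monomial N ℓ e e≤
      c′ , c′≡P = represent-polynomial N ℓ P P≤
  in (λ i → c i xor c′ i) , λ x → trans (evalCoeffs-xor N ℓ c c′ x) (cong₂ _xor_ (c≡e x) (c′≡P x))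

-- The generating-function bound Σ_{i≤ℓ} C(N,i) ≤ z^(-ℓ) (1 + z)^N at z = 1/a, cleared of denominators.
numMonomials-bound : ∀ N ℓ a .{{_ : NonZero a}} → numMonomials N ℓ * a ^ N ≤ a ^ ℓ * suc a ^ N
numMonomials-bound zero ℓ a = ℕₚ.*-monoˡ-≤ 1 (ℕₚ.m^n>0 a ℓ)
numMonomials-bound (suc N) zero a = begin
  numMonomials N 0 * (a * a ^ N)   ≡⟨ ℕₚ.*-assoc (numMonomials N 0) a _ ⟨
  numMonomials N 0 * a * a ^ N     ≡⟨ cong (_* a ^ N) (ℕₚ.*-comm (numMonomials N 0) a) ⟩
  a * numMonomials N 0 * a ^ N     ≡⟨ ℕₚ.*-assoc a _ _ ⟩
  a * (numMonomials N 0 * a ^ N)   ≤⟨ ℕₚ.*-mono-≤ (ℕₚ.n≤1+n a) (numMonomials-bound N 0 a) ⟩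
  suc a * (1 * suc a ^ N)          ≡⟨ cong (suc a *_) (ℕₚ.*-identityˡ _) ⟩
  suc a * suc a ^ N                ≡⟨ ℕₚ.*-identityˡ _ ⟨
  1 * (suc a * suc a ^ N)          ∎
  where open ≤-Reasoning
numMonomials-bound (suc N) (suc ℓ) a = begin
  (M₁ + M₀) * (a * a ^ N)
    ≡⟨ expand M₁ M₀ a (a ^ N) ⟩
  a * (M₁ * a ^ N) + a * (M₀ * a ^ N)
    ≤⟨ ℕₚ.+-mono-≤ (ℕₚ.*-monoʳ-≤ a (numMonomials-bound N (suc ℓ) a))
                   (ℕₚ.*-monoʳ-≤ a (numMonomials-bound N ℓ a)) ⟩
  a * (a * a ^ ℓ * suc a ^ N) + a * (a ^ ℓ * suc a ^ N)
    ≡⟨ collect a (a ^ ℓ) (suc a ^ N) ⟩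
  a * a ^ ℓ * (suc a * suc a ^ N) ∎
  where
  open ≤-Reasoning
  M₁ = numMonomials N (suc ℓ)
  M₀ = numMonomials N ℓ
  expand : ∀ x y a p → (x + y) * (a * p) ≡ a * (x * p) + a * (y * p)
  expand = ℕ-solve-∀
  collect : ∀ a p q → a * (a * p * q) + a * (p * q) ≡ a * p * (suc a * q)
  collect = ℕ-solve-∀

-- Bernoulli: (1 - 1/(a+1))ʲ ≥ 1 - j/(a+1), where r = a + 1 - j.
bernoulli : ∀ a j r → j + r ≡ suc a → suc a ^ j * r ≤ suc a * a ^ j
bernoulli a zero    r refl = ℕₚ.≤-reflexive (trans (ℕₚ.*-identityˡ _) (sym (ℕₚ.*-identityʳ _)))
bernoulli a (suc j) r eq   = begin
  suc a * suc a ^ j * r         ≡⟨ shuffle (suc a) (suc a ^ j) r ⟩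
  suc a ^ j * (suc a * r)       ≤⟨ ℕₚ.*-monoʳ-≤ (suc a ^ j) step ⟩
  suc a ^ j * (suc r * a)       ≡⟨ ℕₚ.*-assoc (suc a ^ j) (suc r) a ⟨
  suc a ^ j * suc r * a         ≤⟨ ℕₚ.*-monoˡ-≤ a (bernoulli a j (suc r) (trans (ℕₚ.+-suc j r) eq)) ⟩
  suc a * a ^ j * a             ≡⟨ shuffle′ (suc a) (a ^ j) a ⟩
  suc a * (a * a ^ j)           ∎
  where
  open ≤-Reasoning
  shuffle : ∀ x y z → x * y * z ≡ y * (x * z)
  shuffle = ℕ-solve-∀
  shuffle′ : ∀ x y z → x * y * z ≡ x * (z * y)
  shuffle′ = ℕ-solve-∀
  r≤a : r ≤ a
  r≤a = ℕₚ.≤-trans (ℕₚ.m≤n+m r j) (ℕₚ.≤-reflexive (ℕₚ.suc-injective eq))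
  step : suc a * r ≤ suc r * a
  step = ℕₚ.+-mono-≤ r≤a (ℕₚ.≤-reflexive (ℕₚ.*-comm a r))

-- Bernoulli with a = 2k and j = k leaves 1 - k/(2k+1) = (k+1)/(2k+1), which exceeds one half.
[2k+1]^k≤2[2k]^k : ∀ k → suc (k + k) ^ k ≤ 2 * (k + k) ^ k
[2k+1]^k≤2[2k]^k k = ℕₚ.*-cancelʳ-≤ _ _ (suc k) (begin
  suc (k + k) ^ k * suc k       ≤⟨ bernoulli (k + k) k (suc k) (ℕₚ.+-suc k k) ⟩
  suc (k + k) * (k + k) ^ k     ≤⟨ ℕₚ.*-monoˡ-≤ ((k + k) ^ k) (ℕₚ.n≤1+n (suc (k + k))) ⟩
  suc (suc (k + k)) * (k + k) ^ k  ≡⟨ shuffle k ((k + k) ^ k) ⟩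
  2 * (k + k) ^ k * suc k       ∎)
  where
  open ≤-Reasoning
  shuffle : ∀ k p → suc (suc (k + k)) * p ≡ 2 * p * suc k
  shuffle = ℕ-solve-∀

-- The choice a = 2k makes each block of k variables cost (1 + 1/(2k))^k, at most 2.
numMonomials-blocks : ∀ d k ℓ .{{_ : NonZero k}} → numMonomials (d * k) ℓ ≤ (k + k) ^ ℓ * 2 ^ d
numMonomials-blocks d k@(suc _) ℓ = ℕₚ.*-cancelʳ-≤ _ _ (a ^ (d * k)) {{ℕₚ.m^n≢0 a (d * k)}} (begin
  numMonomials (d * k) ℓ * a ^ (d * k)
    ≤⟨ numMonomials-bound (d * k) ℓ a ⟩
  a ^ ℓ * suc a ^ (d * k)
    ≡⟨ cong (λ n → a ^ ℓ * suc a ^ n) (ℕₚ.*-comm d k) ⟩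
  a ^ ℓ * suc a ^ (k * d)
    ≡⟨ cong (a ^ ℓ *_) (ℕₚ.^-*-assoc (suc a) k d) ⟨
  a ^ ℓ * (suc a ^ k) ^ d
    ≤⟨ ℕₚ.*-monoʳ-≤ (a ^ ℓ) (ℕₚ.^-monoˡ-≤ d ([2k+1]^k≤2[2k]^k k)) ⟩
  a ^ ℓ * (2 * a ^ k) ^ d
    ≡⟨ cong (a ^ ℓ *_) (^-distribʳ-* d 2 (a ^ k)) ⟩
  a ^ ℓ * (2 ^ d * (a ^ k) ^ d)
    ≡⟨ cong (λ z → a ^ ℓ * (2 ^ d * z)) (trans (ℕₚ.^-*-assoc a k d) (cong (a ^_) (ℕₚ.*-comm k d))) ⟩
  a ^ ℓ * (2 ^ d * a ^ (d * k))
    ≡⟨ ℕₚ.*-assoc (a ^ ℓ) _ _ ⟨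
  a ^ ℓ * 2 ^ d * a ^ (d * k) ∎)
  where open ≤-Reasoning
        a = k + k

-- This calibrates s = 4w: 2k ≤ (2w)² turns (2k)^ℓ into (2w)^(2ℓ), at most (2w)^m because ℓ < d/2,
-- and 2^m doubles the base to 4w.
numMonomials≤2t : ∀ m k ℓ w .{{_ : NonZero k}} .{{_ : NonZero w}} → k ≤ w * w → ℓ + ℓ ≤ m →
  numMonomials (suc m * k) ℓ ≤ 2 * (2 * w + 2 * w) ^ m
numMonomials≤2t m k ℓ w k≤ ℓ≤ = begin
  numMonomials (suc m * k) ℓ       ≤⟨ numMonomials-blocks (suc m) k ℓ ⟩
  (k + k) ^ ℓ * 2 ^ suc m          ≤⟨ ℕₚ.*-monoˡ-≤ (2 ^ suc m) (ℕₚ.^-monoˡ-≤ ℓ 2k≤) ⟩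
  (q * q) ^ ℓ * 2 ^ suc m          ≡⟨ cong (_* 2 ^ suc m) (trans (^-distribʳ-* ℓ q q) (sym (ℕₚ.^-distribˡ-+-* q ℓ ℓ))) ⟩
  q ^ (ℓ + ℓ) * 2 ^ suc m          ≤⟨ ℕₚ.*-monoˡ-≤ (2 ^ suc m) (ℕₚ.^-monoʳ-≤ q {{ℕₚ.m*n≢0 2 w}} ℓ≤) ⟩
  q ^ m * (2 * 2 ^ m)              ≡⟨ shuffle (q ^ m) (2 ^ m) ⟩
  2 * (q ^ m * 2 ^ m)              ≡⟨ cong (2 *_) (^-distribʳ-* m q 2) ⟨
  2 * (q * 2) ^ m                  ≡⟨ cong (λ z → 2 * z ^ m) (double q) ⟩
  2 * (q + q) ^ m                  ∎
  where
  open ≤-Reasoning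
  q = 2 * w
  shuffle : ∀ x y → x * (2 * y) ≡ 2 * (x * y)
  shuffle = ℕ-solve-∀
  double : ∀ x → x * 2 ≡ x + x
  double = ℕ-solve-∀
  square : ∀ w → (w * w + w * w) + (w * w + w * w) ≡ 2 * w * (2 * w)
  square = ℕ-solve-∀
  2k≤ : k + k ≤ q * q
  2k≤ = begin
    k + k                               ≤⟨ ℕₚ.+-mono-≤ k≤ k≤ ⟩
    w * w + w * w                       ≤⟨ ℕₚ.m≤m+n _ _ ⟩
    (w * w + w * w) + (w * w + w * w)   ≡⟨ square w ⟩
    q * q                               ∎

-- From the moment bound to all polynomials: Markov and the union bound.

corrBelow-intro : ∀ N k ε e f g .{{_ : NonZero k}} → ↥ ε ℤ.* ℤ.+ k ≡ ℤ.+ e ℤ.* ↧ ε →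
                  corrNum N f g * 2 ^ k < 2 ^ (N + e) → CorrBelow N k ε f g
corrBelow-intro N k@(suc _) ε e f g ε≡e/k small with ↥ ε
... | ℤ.-[1+ _ ] with () ← trans ε≡e/k (sym (ℤₚ.pos-* e (↧ₙ ε)))
... | ℤ.+ p = begin-strict
  corr ^ q * 2 ^ (q * k)         ≡⟨ cong (λ z → corr ^ q * 2 ^ z) (ℕₚ.*-comm q k) ⟩
  corr ^ q * 2 ^ (k * q)         ≡⟨ cong (corr ^ q *_) (ℕₚ.^-*-assoc 2 k q) ⟨
  corr ^ q * (2 ^ k) ^ q         ≡⟨ ^-distribʳ-* q corr (2 ^ k) ⟨
  (corr * 2 ^ k) ^ q             <⟨ ℕₚ.^-monoˡ-< q small ⟩
  (2 ^ (N + e)) ^ q              ≡⟨ ℕₚ.^-*-assoc 2 (N + e) q ⟩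
  2 ^ ((N + e) * q)              ≡⟨ cong (2 ^_) (ℕₚ.*-distribʳ-+ q N e) ⟩
  2 ^ (N * q + e * q)            ≡⟨ ℕₚ.^-distribˡ-+-* 2 (N * q) (e * q) ⟩
  2 ^ (N * q) * 2 ^ (e * q)      ≡⟨ cong (λ z → 2 ^ (N * q) * 2 ^ z) pk≡eq ⟨
  2 ^ (N * q) * 2 ^ (p * k)      ∎
  where
  open ≤-Reasoning
  q = ↧ₙ ε
  corr = corrNum N f g
  -- ε is in lowest terms, so p/q agrees with e/k only after cross-multiplication; the plain
  -- inequality is therefore raised to the power q, not k.
  pk≡eq : p * k ≡ e * q
  pk≡eq = ℤₚ.+-injective (trans (ℤₚ.pos-* p k) (trans ε≡e/k (sym (ℤₚ.pos-* e q))))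

corrNum-cong : ∀ N f {g h} → (∀ x → g x ≡ h x) → corrNum N f g ≡ corrNum N f h
corrNum-cong N f g≡h =
  cong ℤ.∣_∣ (ℤ∑.∑-cong (allVecs N) (λ x → cong (λ b → sign (f x xor b)) (g≡h x)))

-- The pointwise inequality behind Markov for the t-th moment.
bit-threshold : ∀ a b t → bit (a ≤ᵇ b) * a ^ t ≤ b ^ t
bit-threshold a b t with a ≤ᵇ b in eq
... | false = z≤n
... | true  = ℕₚ.≤-trans (ℕₚ.≤-reflexive (ℕₚ.*-identityˡ _)) (ℕₚ.^-monoˡ-≤ t (≤ᵇ-sound a b eq))

bit≤count : ∀ {A : Set} (xs : List A) p → bit (1 ≤ᵇ count xs p) ≤ count xs p
bit≤count xs p with count xs p
... | zero  = z≤n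
... | suc _ = s≤s z≤n

module Uncorrelated (m k ℓ e : ℕ) where
  private
    N = suc m * k
    M = numMonomials N ℓ
    Ts = allTensors (suc m) k
    -- This is 2^N times 2^(e - k), the permitted correlation for ε = e/k.
    threshold = 2 ^ (m * k + e)

  corr : (Fin M → Bool) → Tensor (suc m) k → ℕ
  corr c T = corrNum N (formOnFlat {suc m} {k} T) (evalCoeffs N ℓ c)

  correlated : (Fin M → Bool) → Tensor (suc m) k → Bool
  correlated c T = threshold ≤ᵇ corr c T

  -- Ranging over coefficient vectors instead of polynomials makes the bad event decidable and the
  -- union finite.
  somewhere-correlated : Tensor (suc m) k → Bool
  somewhere-correlated T = 1 ≤ᵇ count (allVecs M) (λ c → correlated c T)

  uncorrelated-sound : ∀ T → somewhere-correlated T ≡ false → ∀ P → DegAtMost ℓ P →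
                       corrNum N (formOnFlat {suc m} {k} T) (evalPoly P) * 2 ^ k < 2 ^ (N + e)
  uncorrelated-sound T none P deg≤ = begin-strict
    corrNum N (formOnFlat {suc m} {k} T) (evalPoly P) * 2 ^ k
      ≡⟨ cong (_* 2 ^ k) (corrNum-cong N (formOnFlat {suc m} {k} T) c≡P) ⟨
    corr c T * 2 ^ k
      <⟨ ℕₚ.*-monoˡ-< (2 ^ k) {{ℕₚ.m^n≢0 2 k}} (ℕₚ.≰⇒> below) ⟩
    threshold * 2 ^ k
      ≡⟨ ℕₚ.^-distribˡ-+-* 2 (m * k + e) k ⟨
    2 ^ (m * k + e + k)
      ≡⟨ cong (2 ^_) (trans (ℕₚ.+-comm _ k) (sym (ℕₚ.+-assoc k (m * k) e))) ⟩
    2 ^ (N + e) ∎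
    where
    open ≤-Reasoning
    rep = represent-polynomial N ℓ P deg≤
    c = proj₁ rep
    c≡P = proj₂ rep
    below : threshold ≤ corr c T → ⊥
    below large = case trans (sym none) (≤ᵇ-complete 1 _ (begin
      1                          ≡⟨ cong bit (≤ᵇ-complete threshold _ large) ⟨
      bit (correlated c T)       ≤⟨ FinSpace.term≤∑ (power M boolSpace) _ (λ c≗c′ →
                                      cong (λ z → bit (threshold ≤ᵇ z))
                                        (corrNum-cong N (formOnFlat {suc m} {k} T) (evalCoeffs-cong N ℓ c≗c′))) c ⟩
      count (allVecs M) (λ c → correlated c T) ∎)) of λ ()

  -- In `e`, the part lg + s covers the moment rate (m+1) 2^s. The margin 2 + w is raised to the
  -- power t by Markov: the 2 pays for the at most 2^(2t) functions, and w is left as failure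
  -- probability.
  module Rare (w lg : ℕ) .{{_ : NonZero k}} .{{_ : NonZero w}} (k≤w² : k ≤ w * w)
              (ℓ+ℓ≤m : ℓ + ℓ ≤ m) (m<2^lg : suc m ≤ 2 ^ lg)
              (e≡ : e ≡ (lg + (2 * w + 2 * w)) + (2 + w)) where
    private
      s = 2 * w + 2 * w
      t = s ^ m
      base = m * k + (lg + s)

    rate≤ : Moments.rate m k s ≤ 2 ^ base
    rate≤ = begin
      2 ^ (m * k) * (suc m * 2 ^ s)    ≤⟨ ℕₚ.*-monoʳ-≤ (2 ^ (m * k)) (ℕₚ.*-monoˡ-≤ (2 ^ s) m<2^lg) ⟩
      2 ^ (m * k) * (2 ^ lg * 2 ^ s)   ≡⟨ cong (2 ^ (m * k) *_) (ℕₚ.^-distribˡ-+-* 2 lg s) ⟨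
      2 ^ (m * k) * 2 ^ (lg + s)       ≡⟨ ℕₚ.^-distribˡ-+-* 2 (m * k) (lg + s) ⟨
      2 ^ base                         ∎
      where open ≤-Reasoning

    threshold≡ : threshold ≡ 2 ^ (2 + w) * 2 ^ base
    threshold≡ = begin
      2 ^ (m * k + e)                    ≡⟨ cong (λ z → 2 ^ (m * k + z)) e≡ ⟩
      2 ^ (m * k + (lg + s + (2 + w)))   ≡⟨ cong (2 ^_) (ℕₚ.+-assoc (m * k) (lg + s) (2 + w)) ⟨
      2 ^ (base + (2 + w))               ≡⟨ ℕₚ.^-distribˡ-+-* 2 base (2 + w) ⟩
      2 ^ base * 2 ^ (2 + w)             ≡⟨ ℕₚ.*-comm (2 ^ base) _ ⟩
      2 ^ (2 + w) * 2 ^ base             ∎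
      where open ≡-Reasoning

    -- When d = 1 the degree bound is 0, which supplies the constancy that `moment` demands in that
    -- case.
    degree-zero : ∀ c → m ≡ 0 → ∃ λ b → ∀ x → evalCoeffs N ℓ c x ≡ b
    degree-zero = aux ℓ (ℕₚ.m+n≤o⇒m≤o ℓ ℓ+ℓ≤m)
      where
      aux : ∀ ℓ → ℓ ≤ m → ∀ c → m ≡ 0 → ∃ λ b → ∀ x → evalCoeffs N ℓ c x ≡ b
      aux zero    ℓ≤ c eq = evalCoeffs-degree-zero N c
      aux (suc ℓ) ℓ≤ c eq with () ← subst (suc ℓ ≤_) eq ℓ≤

    correlated-rare : ∀ c → count Ts (correlated c) * (2 ^ (2 + w)) ^ t ≤ length Ts
    correlated-rare c = ℕₚ.*-cancelʳ-≤ _ _ ((2 ^ base) ^ t) {{ℕₚ.m^n≢0 (2 ^ base) t {{ℕₚ.m^n≢0 2 base}}}} (begin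
      count Ts (correlated c) * (2 ^ (2 + w)) ^ t * (2 ^ base) ^ t
        ≡⟨ ℕₚ.*-assoc (count Ts (correlated c)) _ _ ⟩
      count Ts (correlated c) * ((2 ^ (2 + w)) ^ t * (2 ^ base) ^ t)
        ≡⟨ cong (count Ts (correlated c) *_) (trans (sym (^-distribʳ-* t (2 ^ (2 + w)) (2 ^ base)))
             (cong (_^ t) (sym threshold≡))) ⟩
      count Ts (correlated c) * threshold ^ t
        ≡⟨ *-distribʳ-∑ Ts (threshold ^ t) _ ⟩
      ∑ Ts (λ T → bit (correlated c T) * threshold ^ t)
        ≤⟨ ∑-mono Ts (λ T → bit-threshold threshold (corr c T) t) ⟩
      ∑ Ts (λ T → corr c T ^ t)
        ≤⟨ moment m k (2 * w) (evalCoeffs N ℓ c) (degree-zero c) ⟩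
      length Ts * Moments.rate m k s ^ t
        ≤⟨ ℕₚ.*-monoʳ-≤ (length Ts) (ℕₚ.^-monoˡ-≤ t rate≤) ⟩
      length Ts * (2 ^ base) ^ t ∎)
      where open ≤-Reasoning

    t-pos : 1 ≤ t
    t-pos = ℕₚ.m^n>0 s {{>-nonZero (ℕₚ.≤-trans (>-nonZero⁻¹ (2 * w) {{ℕₚ.m*n≢0 2 w}}) (ℕₚ.m≤m+n (2 * w) (2 * w)))}} m

    somewhere-correlated-rare : count Ts somewhere-correlated * 2 ^ w ≤ length Ts
    somewhere-correlated-rare = ℕₚ.*-cancelʳ-≤ _ _ (2 ^ M) {{ℕₚ.m^n≢0 2 M}} (begin
      count Ts somewhere-correlated * 2 ^ w * 2 ^ M
        ≡⟨ ℕₚ.*-assoc (count Ts somewhere-correlated) _ _ ⟩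
      count Ts somewhere-correlated * (2 ^ w * 2 ^ M)
        ≡⟨ cong (count Ts somewhere-correlated *_) (ℕₚ.^-distribˡ-+-* 2 w M) ⟨
      count Ts somewhere-correlated * 2 ^ (w + M)
        ≤⟨ ℕₚ.*-mono-≤ (∑-mono Ts (λ T → bit≤count (allVecs M) (λ c → correlated c T)))
                       (ℕₚ.^-monoʳ-≤ 2 exponent) ⟩
      ∑ Ts (λ T → count (allVecs M) (λ c → correlated c T)) * 2 ^ ((2 + w) * t)
        ≡⟨ cong₂ _*_ (∑-swap Ts (allVecs M) _) (sym (ℕₚ.^-*-assoc 2 (2 + w) t)) ⟩
      ∑ (allVecs M) (λ c → count Ts (correlated c)) * (2 ^ (2 + w)) ^ t
        ≡⟨ *-distribʳ-∑ (allVecs M) _ _ ⟩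
      ∑ (allVecs M) (λ c → count Ts (correlated c) * (2 ^ (2 + w)) ^ t)
        ≤⟨ ∑-mono (allVecs M) correlated-rare ⟩
      ∑ (allVecs M) (λ c → length Ts)
        ≡⟨ ∑-const (allVecs M) (length Ts) ⟩
      length (allVecs M) * length Ts
        ≡⟨ trans (cong (_* length Ts) (length-allVecs M)) (ℕₚ.*-comm (2 ^ M) _) ⟩
      length Ts * 2 ^ M ∎)
      where
      open ≤-Reasoning
      exponent : w + M ≤ (2 + w) * t
      exponent = begin
        w + M            ≤⟨ ℕₚ.+-mono-≤ (ℕₚ.≤-trans (ℕₚ.≤-reflexive (sym (ℕₚ.*-identityʳ w))) (ℕₚ.*-monoʳ-≤ w t-pos))
                              (numMonomials≤2t m k ℓ w k≤w² ℓ+ℓ≤m) ⟩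
        w * t + 2 * t    ≡⟨ ℕₚ.*-distribʳ-+ t w 2 ⟨
        (w + 2) * t      ≡⟨ cong (_* t) (ℕₚ.+-comm w 2) ⟩
        (2 + w) * t      ∎

-- Elementary estimates for square roots, logarithms and rationals.

ceilSqrt : ℕ → ℕ
ceilSqrt zero    = 0
ceilSqrt (suc k) with suc k ℕₚ.≤? ceilSqrt k * ceilSqrt k
... | yes _ = ceilSqrt k
... | no  _ = suc (ceilSqrt k)

ceilSqrt-lower : ∀ k → k ≤ ceilSqrt k * ceilSqrt k
ceilSqrt-lower zero    = z≤n
ceilSqrt-lower (suc k) with suc k ℕₚ.≤? ceilSqrt k * ceilSqrt k
... | yes le = le
... | no  _  = s≤s (ℕₚ.≤-trans (ceilSqrt-lower k) (ℕₚ.≤-trans (ℕₚ.*-monoʳ-≤ w (ℕₚ.n≤1+n w)) (ℕₚ.m≤n+m _ w)))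
  where w = ceilSqrt k

ceilSqrt-upper : ∀ k → ceilSqrt k * ceilSqrt k ≤ 4 * k
ceilSqrt-upper zero    = z≤n
ceilSqrt-upper (suc k) with suc k ℕₚ.≤? ceilSqrt k * ceilSqrt k
... | yes _  = ℕₚ.≤-trans (ceilSqrt-upper k) (ℕₚ.*-monoʳ-≤ 4 (ℕₚ.n≤1+n k))
... | no  gt = begin
  suc w * suc w                  ≡⟨ square w ⟩
  w * w + 2 * w + 1              ≤⟨ ℕₚ.+-monoˡ-≤ 1 (ℕₚ.+-mono-≤ w²≤k 2w≤) ⟩
  k + (2 * k + 1) + 1            ≤⟨ ℕₚ.m≤m+n _ (k + 2) ⟩
  k + (2 * k + 1) + 1 + (k + 2)  ≡⟨ collect k ⟩
  4 * suc k                      ∎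
  where
  open ≤-Reasoning
  w = ceilSqrt k
  square : ∀ w → suc w * suc w ≡ w * w + 2 * w + 1
  square = ℕ-solve-∀
  collect : ∀ k → k + (2 * k + 1) + 1 + (k + 2) ≡ 4 * suc k
  collect = ℕ-solve-∀
  w²≤k : w * w ≤ k
  w²≤k = ℕₚ.≤-pred (ℕₚ.≰⇒> gt)
  w≤w² : ∀ v → v ≤ v * v
  w≤w² zero    = z≤n
  w≤w² (suc v) = ℕₚ.m≤m*n (suc v) (suc v)
  2w≤ : 2 * w ≤ 2 * k + 1
  2w≤ = ℕₚ.≤-trans (ℕₚ.*-monoʳ-≤ 2 (ℕₚ.≤-trans (w≤w² w) w²≤k)) (ℕₚ.m≤m+n (2 * k) 1)

-- A quantitative form of √k = o(k). A root w ≥ 4j gives 4jw ≤ w² ≤ 4k; a root w ≤ 4j gives jw ≤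
-- 4j².
*-ceilSqrt≤ : ∀ j k → j * (4 * j) ≤ k → j * ceilSqrt k ≤ k
*-ceilSqrt≤ j k j²≤k with ℕₚ.≤-total (4 * j) (ceilSqrt k)
... | inj₂ w≤4j = ℕₚ.≤-trans (ℕₚ.*-monoʳ-≤ j w≤4j) j²≤k
... | inj₁ 4j≤w = ℕₚ.*-cancelˡ-≤ 4 (begin
  4 * (j * ceilSqrt k)        ≡⟨ ℕₚ.*-assoc 4 j (ceilSqrt k) ⟨
  4 * j * ceilSqrt k          ≤⟨ ℕₚ.*-monoˡ-≤ (ceilSqrt k) 4j≤w ⟩
  ceilSqrt k * ceilSqrt k     ≤⟨ ceilSqrt-upper k ⟩
  4 * k                       ∎)
  where open ≤-Reasoning

≤-ceilSqrt : ∀ q k → q * q ≤ k → q ≤ ceilSqrt k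
≤-ceilSqrt q k q²≤k = ℕₚ.≮⇒≥ λ w<q →
  ℕₚ.<⇒≱ (ℕₚ.*-mono-< w<q w<q) (ℕₚ.≤-trans q²≤k (ceilSqrt-lower k))

n≤2^n : ∀ n → n ≤ 2 ^ n
n≤2^n zero    = z≤n
n≤2^n (suc n) = begin
  1 + n              ≤⟨ ℕₚ.+-mono-≤ (ℕₚ.m^n>0 2 n) (n≤2^n n) ⟩
  2 ^ n + 2 ^ n      ≡⟨ cong (2 ^ n +_) (ℕₚ.+-identityʳ (2 ^ n)) ⟨
  2 ^ suc n          ∎
  where open ≤-Reasoning

n≤2^1+⌊log₂n⌋ : ∀ n → n ≤ 2 ^ suc ⌊log₂ n ⌋
n≤2^1+⌊log₂n⌋ n = ℕₚ.<⇒≤ (ℕₚ.≰⇒> λ 2^≤n → ℕₚ.1+n≰n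
  (ℕₚ.≤-trans (ℕₚ.≤-reflexive (sym (⌊log₂[2^n]⌋≡n (suc ⌊log₂ n ⌋)))) (⌊log₂⌋-mono-≤ 2^≤n)))

frac-num : ∀ e k .{{_ : NonZero k}} → ↥ (ℤ.+ e ℚ./ k) ℤ.* ℤ.+ k ≡ ℤ.+ e ℤ.* ↧ (ℤ.+ e ℚ./ k)
frac-num e (suc k) = unwrap (ℤ.+ e ℚ./ suc k) (ℚₚ.toℚᵘ-fromℚᵘ (ℚᵘ.mkℚᵘ (ℤ.+ e) k))
  where
  unwrap : ∀ p → ℚ.toℚᵘ p ℚᵘ.≃ ℚᵘ.mkℚᵘ (ℤ.+ e) k → ↥ p ℤ.* ℤ.+ suc k ≡ ℤ.+ e ℤ.* ↧ p
  unwrap (ℚ.mkℚ _ _ _) (ℚᵘ.*≡* eq) = eq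

-- A positive δ is at least 1 over its denominator, and e/k is compared with that unit fraction.
abs<-intro : ∀ ε δ e k .{{_ : NonZero k}} → ↥ ε ℤ.* ℤ.+ k ≡ ℤ.+ e ℤ.* ↧ ε → 0ℚ ℚ.< δ →
             e * ↧ₙ δ < k → ℚ.∣ ε ∣ ℚ.< δ
abs<-intro (ℚ.mkℚ ℤ.-[1+ n ] b _) δ e (suc k) eq 0<δ small
  with () ← trans eq (sym (ℤₚ.pos-* e (suc b)))
abs<-intro ε δ@(ℚ.mkℚ (ℤ.+ zero) _ _) e k eq (ℚ.*<* (ℤ.+<+ ())) small
abs<-intro ε δ@(ℚ.mkℚ ℤ.-[1+ _ ] _ _) e k eq (ℚ.*<* ()) small
abs<-intro (ℚ.mkℚ (ℤ.+ a) b _) (ℚ.mkℚ (ℤ.+ suc p) c _) e k@(suc _) eq 0<δ small =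
  ℚ.*<* (subst₂ ℤ._<_ (ℤₚ.pos-* a (suc c)) (ℤₚ.pos-* (suc p) (suc b)) (ℤ.+<+ (begin-strict
    a * suc c          <⟨ ℕₚ.*-cancelʳ-< k _ _ scaled ⟩
    suc b              ≤⟨ ℕₚ.m≤m+n (suc b) (p * suc b) ⟩
    suc p * suc b      ∎)))
  where
  open ≤-Reasoning
  ak≡eb : a * k ≡ e * suc b
  ak≡eb = ℤₚ.+-injective (trans (ℤₚ.pos-* a k) (trans eq (sym (ℤₚ.pos-* e (suc b)))))
  shuffle : ∀ x y z → x * y * z ≡ x * z * y
  shuffle = ℕ-solve-∀
  scaled : a * suc c * k < suc b * k
  scaled = begin-strict
    a * suc c * k         ≡⟨ shuffle a (suc c) k ⟩
    a * k * suc c         ≡⟨ cong (_* suc c) ak≡eb ⟩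
    e * suc b * suc c     ≡⟨ shuffle e (suc b) (suc c) ⟩
    e * suc c * suc b     <⟨ ℕₚ.*-monoˡ-< (suc b) small ⟩
    k * suc b             ≡⟨ ℕₚ.*-comm k (suc b) ⟩
    suc b * k             ∎

toℚᵘ-toℚ : ∀ n → ℚ.toℚᵘ (toℚ n) ℚᵘ.≃ ℚᵘ.mkℚᵘ (ℤ.+ n) 0
toℚᵘ-toℚ n = ℚₚ.toℚᵘ-fromℚᵘ (ℚᵘ.mkℚᵘ (ℤ.+ n) 0)

toℚ<unit-fraction : ∀ x n J .{{_ : NonZero J}} →
                    toℚ x ℚ.< (ℤ.+ 1 ℚ./ J) ℚ.* toℚ n → x * J < n
toℚ<unit-fraction x n (suc j) lt
  with ℚᵘ.*<* lt′ ← ℚᵘₚ.<-respˡ-≃ (toℚᵘ-toℚ x) (ℚᵘₚ.<-respʳ-≃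
         (ℚᵘₚ.≃-trans (ℚₚ.toℚᵘ-homo-* (ℤ.+ 1 ℚ./ suc j) (toℚ n))
           (ℚᵘₚ.*-cong (ℚₚ.toℚᵘ-fromℚᵘ (ℚᵘ.mkℚᵘ (ℤ.+ 1) j)) (toℚᵘ-toℚ n)))
         (ℚₚ.toℚᵘ-mono-< lt))
  = ℤₚ.drop‿+<+ (subst₂ ℤ._<_
      (trans (cong (λ z → ℤ.+ x ℤ.* ℤ.+ z) (ℕₚ.*-identityʳ (suc j))) (sym (ℤₚ.pos-* x (suc j))))
      (trans (ℤₚ.*-identityʳ _) (ℤₚ.*-identityˡ _)) lt′)

-- Again δ is replaced by the unit fraction below it: the failures `B` are at most that share of
-- `A`.
prob-intro : ∀ δ A G B → 0ℚ ℚ.< δ → G + B ≡ A → B * ↧ₙ δ ≤ A → (1ℚ ℚ.- δ) ℚ.* toℚ A ℚ.≤ toℚ G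
prob-intro (ℚ.mkℚ (ℤ.+ zero) _ _) A G B (ℚ.*<* (ℤ.+<+ ())) _ _
prob-intro (ℚ.mkℚ ℤ.-[1+ _ ] _ _) A G B (ℚ.*<* ()) _ _
prob-intro δ@(ℚ.mkℚ (ℤ.+ suc p) b _) A G B _ refl few = ℚₚ.toℚᵘ-cancel-≤
  (ℚᵘₚ.≤-respˡ-≃ (ℚᵘₚ.≃-sym (ℚᵘₚ.≃-trans (ℚₚ.toℚᵘ-homo-* (1ℚ ℚ.- δ) (toℚ A))
      (ℚᵘₚ.*-cong (ℚₚ.toℚᵘ-homo-+ 1ℚ (ℚ.- δ)) (toℚᵘ-toℚ A))))
    (ℚᵘₚ.≤-respʳ-≃ (ℚᵘₚ.≃-sym (toℚᵘ-toℚ G)) (ℚᵘ.*≤* main)))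
  where
  X Y : ℤ
  X = ℤ.+ suc b
  Y = ℤ.+ suc p

  difference : ∀ X Y G B →
    Y ℤ.* (G ℤ.+ B) ℤ.- X ℤ.* B
      ≡ G ℤ.* X ℤ.- (ℤ.+ 1 ℤ.* X ℤ.+ (ℤ.- Y) ℤ.* ℤ.+ 1) ℤ.* (G ℤ.+ B) ℤ.* ℤ.+ 1
  difference = ℤ-solve-∀

  XB≤YA : X ℤ.* ℤ.+ B ℤ.≤ Y ℤ.* ℤ.+ (G + B)
  XB≤YA = subst₂ ℤ._≤_ (ℤₚ.pos-* (suc b) B) (ℤₚ.pos-* (suc p) (G + B)) (ℤ.+≤+ (begin
    suc b * B            ≡⟨ ℕₚ.*-comm (suc b) B ⟩
    B * suc b            ≤⟨ few ⟩
    G + B                ≤⟨ ℕₚ.m≤m+n (G + B) (p * (G + B)) ⟩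
    suc p * (G + B)      ∎))
    where open ≤-Reasoning

  main : (ℤ.+ 1 ℤ.* X ℤ.+ (ℤ.- Y) ℤ.* ℤ.+ 1) ℤ.* ℤ.+ (G + B) ℤ.* ℤ.+ 1
           ℤ.≤ ℤ.+ G ℤ.* ℤ.+ ((1 * suc b) * 1)
  main = subst (λ z → (ℤ.+ 1 ℤ.* X ℤ.+ (ℤ.- Y) ℤ.* ℤ.+ 1) ℤ.* ℤ.+ (G + B) ℤ.* ℤ.+ 1 ℤ.≤ ℤ.+ G ℤ.* ℤ.+ z)
    (sym (trans (ℕₚ.*-identityʳ _) (ℕₚ.*-identityˡ (suc b))))
    (ℤₚ.0≤i-j⇒j≤i (subst (ℤ.0ℤ ℤ.≤_)
      (difference X Y (ℤ.+ G) (ℤ.+ B)) (ℤₚ.i≤j⇒0≤j-i XB≤YA)))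

-- The error term, the good tensors and the assembly.

length-filter-count : ∀ {A : Set} (xs : List A) (p : A → Bool) →
                      length (filter (λ x → p x Boolₚ.≟ true) xs) ≡ count xs p
length-filter-count []       p = refl
length-filter-count (x ∷ xs) p with p x
... | false = length-filter-count xs p
... | true  = cong suc (length-filter-count xs p)

count-not : ∀ {A : Set} (xs : List A) (p : A → Bool) → count xs (not ∘ p) + count xs p ≡ length xs
count-not xs p = trans (sym (∑-distrib-+ xs _ _)) (trans (∑-cong xs (λ x → complement (p x))) (sym (length-∑ xs)))
  where
  complement : ∀ b → bit (not b) + bit b ≡ 1
  complement false = refl
  complement true  = refl

-- The exponent e with log d bounded by `suc L`, where `L` will be the floor of log₂ n.
excess : ℕ → ℕ → ℕ
excess L k = (suc L + (2 * w + 2 * w)) + (2 + w)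
  where w = ceilSqrt k

epsilon : ℕ → ℕ → ℚ
epsilon L zero        = 0ℚ
epsilon L k@(suc _)   = ℤ.+ excess L k ℚ./ k

-- Degenerate sizes are declared bad, which makes soundness vacuous there; they do not occur for
-- large n.
good : (d k ℓ L : ℕ) → Tensor d k → Bool
good zero    k         ℓ L T = false
good (suc m) zero      ℓ L T = false
good (suc m) k@(suc _) ℓ L T = not (Uncorrelated.somewhere-correlated m k ℓ (excess L k) T)

good-sound : (d k ℓ L : ℕ) (T : Tensor d k) → good d k ℓ L T ≡ true → ∀ P → DegAtMost ℓ P →
             CorrBelow (d * k) k (epsilon L k) (formOnFlat {d} {k} T) (evalPoly P)
good-sound (suc m) k@(suc _) ℓ L T g P deg≤ =
  corrBelow-intro (suc m * k) k (epsilon L k) (excess L k) _ _ (frac-num (excess L k) k)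
    (uncorrelated-sound T (Boolₚ.not-injective g) P deg≤)
  where open Uncorrelated m k ℓ (excess L k)

-- The failure probability is at most 2^(-w). With q the denominator of δ, q² ≤ k gives q ≤ w ≤ 2^w,
-- hence at most 1/q ≤ δ.
good-probable : (d k ℓ L : ℕ) (δ : ℚ) → 0ℚ ℚ.< δ → 2 * ℓ < d → d ≤ 2 ^ suc L → 1 ≤ k → ↧ₙ δ * ↧ₙ δ ≤ k →
  (1ℚ ℚ.- δ) ℚ.* toℚ (length (allTensors d k)) ℚ.≤ toℚ (countTensors d k (good d k ℓ L))
good-probable (suc m) k@(suc _) ℓ L δ 0<δ (s≤s 2ℓ≤m) d≤ _ q²≤k =
  subst (λ G → (1ℚ ℚ.- δ) ℚ.* toℚ (length Ts) ℚ.≤ toℚ G)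
    (sym (length-filter-count Ts (good (suc m) k ℓ L)))
    (prob-intro δ (length Ts) (count Ts (not ∘ somewhere-correlated)) (count Ts somewhere-correlated) 0<δ (count-not Ts somewhere-correlated)
      (ℕₚ.≤-trans (ℕₚ.*-monoʳ-≤ (count Ts somewhere-correlated) q≤2^w) somewhere-correlated-rare))
  where
  Ts = allTensors (suc m) k
  w = ceilSqrt k
  open Uncorrelated m k ℓ (excess L k)
  q≤w : ↧ₙ δ ≤ w
  q≤w = ≤-ceilSqrt (↧ₙ δ) k q²≤k
  q≤2^w : ↧ₙ δ ≤ 2 ^ w
  q≤2^w = ℕₚ.≤-trans q≤w (n≤2^n w)
  open Rare w (suc L) {{_}} {{>-nonZero (ℕₚ.≤-trans (s≤s z≤n) q≤w)}} (ceilSqrt-lower k)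
    (subst (_≤ m) (cong (ℓ +_) (ℕₚ.+-identityʳ ℓ)) 2ℓ≤m) d≤ refl

-- Four times the excess splits into 4(L+3) and 20w, and after scaling by q each part is at most k.
-- The constant 4(20q)² is what `*-ceilSqrt≤` requires for j = 20q; it also dominates the
-- logarithmic part.
excess-small : ∀ q L k → 1 ≤ q → 1 ≤ L → L * ((20 * q) * (4 * (20 * q))) < k → excess L k * q < k
excess-small q L k 1≤q 1≤L large = ℕₚ.*-cancelˡ-< 4 _ _ (begin-strict
  4 * (excess L k * q)
    ≡⟨ split L w q ⟩
  4 * ((L + 3) * q) + 20 * q * w
    ≤⟨ ℕₚ.+-mono-≤ logs (*-ceilSqrt≤ (20 * q) k (ℕₚ.<⇒≤ (ℕₚ.≤-<-trans J≤LJ large))) ⟩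
  L * J + k
    <⟨ ℕₚ.+-monoˡ-< k large ⟩
  k + k
    ≤⟨ ℕₚ.m≤m+n (k + k) (k + k) ⟩
  (k + k) + (k + k)
    ≡⟨ quadruple k ⟩
  4 * k ∎)
  where
  open ≤-Reasoning
  w = ceilSqrt k
  J = (20 * q) * (4 * (20 * q))
  split : ∀ L w q → 4 * (((suc L + (2 * w + 2 * w)) + (2 + w)) * q) ≡ 4 * ((L + 3) * q) + 20 * q * w
  split = ℕ-solve-∀
  quadruple : ∀ k → (k + k) + (k + k) ≡ 4 * k
  quadruple = ℕ-solve-∀
  J≤LJ : J ≤ L * J
  J≤LJ = ℕₚ.≤-trans (ℕₚ.≤-reflexive (sym (ℕₚ.*-identityˡ J))) (ℕₚ.*-monoˡ-≤ J 1≤L)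
  regroup : ∀ L q → 4 * ((L + L * 3) * q) ≡ L * (16 * q * 1)
  regroup = ℕ-solve-∀
  enlarge : ∀ q → 1600 * q * q ≡ (20 * q) * (4 * (20 * q))
  enlarge = ℕ-solve-∀
  logs : 4 * ((L + 3) * q) ≤ L * J
  logs = begin
    4 * ((L + 3) * q)      ≤⟨ ℕₚ.*-monoʳ-≤ 4 (ℕₚ.*-monoˡ-≤ q (ℕₚ.+-monoʳ-≤ L (ℕₚ.*-monoˡ-≤ 3 1≤L))) ⟩
    4 * ((L + L * 3) * q)  ≡⟨ regroup L q ⟩
    L * (16 * q * 1)       ≤⟨ ℕₚ.*-monoʳ-≤ L (ℕₚ.*-mono-≤ (ℕₚ.*-monoˡ-≤ q (ℕₚ.m≤m+n 16 1584)) 1≤q) ⟩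
    L * (1600 * q * q)     ≡⟨ cong (L *_) (enlarge q) ⟩
    L * J                  ∎

-- With n = dk, dividing d log n = o(n) by d gives log n = o(k). This one fact drives both the error
-- term and the probability.
block-growth : ∀ d (d∣n : ∀ n → d n ∣ n) → LittleONOverLog d → (∀ n → 1 ≤ d n) →
  ∀ J .{{_ : NonZero J}} → Σ ℕ λ N₀ → ∀ n → N₀ ≤ n →
    1 ≤ n × 1 ≤ ⌊log₂ n ⌋ × ⌊log₂ n ⌋ * J < quotient (d∣n n)
block-growth d d∣n o[n/log] d-pos J =
  let N , small = o[n/log] (ℤ.+ 1 ℚ./ J) (ℚₚ.positive⁻¹ (ℤ.+ 1 ℚ./ J) {{ℚₚ.normalize-pos 1 J}})
  -- Starting at 2 makes the floor of log₂ n at least 1.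
  in 2 + N , λ n N≤n →
    let 2≤n = ℕₚ.≤-trans (ℕₚ.m≤m+n 2 N) N≤n
    in ℕₚ.≤-trans (s≤s z≤n) 2≤n
     , ⌊log₂⌋-mono-≤ 2≤n
     , cancel n (toℚ<unit-fraction (d n * ⌊log₂ n ⌋) n J (small n (ℕₚ.≤-trans (ℕₚ.m≤n+m N 2) N≤n)))
  where
  cancel : ∀ n → d n * ⌊log₂ n ⌋ * J < n → ⌊log₂ n ⌋ * J < quotient (d∣n n)
  cancel n lt = ℕₚ.*-cancelˡ-< (d n) _ _ (begin-strict
    d n * (⌊log₂ n ⌋ * J)       ≡⟨ ℕₚ.*-assoc (d n) _ J ⟨
    d n * ⌊log₂ n ⌋ * J         <⟨ lt ⟩
    n                           ≡⟨ _∣_.equality (d∣n n) ⟩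
    quotient (d∣n n) * d n      ≡⟨ ℕₚ.*-comm _ (d n) ⟩
    d n * quotient (d∣n n)      ∎)
    where open ≤-Reasoning

theorem3p1 : (d ℓ : ℕ → ℕ) (d∣n : ∀ n → d n ∣ n) →
    LittleONOverLog d →
    (∀ n → 2 * ℓ n < d n) →
    Σ (ℕ → ℚ) λ ε → TendsToZero ε ×
    Σ ((n : ℕ) → Tensor (d n) (quotient (d∣n n)) → Bool) λ Good →
    (∀ n (T : Tensor (d n) (quotient (d∣n n))) → Good n T ≡ true →
    ∀ (P : Poly (d n * quotient (d∣n n))) → DegAtMost (ℓ n) P →
    CorrBelow (d n * quotient (d∣n n)) (quotient (d∣n n)) (ε n)
    (formOnFlat T) (evalPoly P)) ×
    ProbTendsToOne d (λ n → quotient (d∣n n)) Good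
theorem3p1 d ℓ d∣n o[n/log] 2ℓ<d =
  (λ n → epsilon ⌊log₂ n ⌋ (k n)) , ε→0 ,
  (λ n → good (d n) (k n) (ℓ n) ⌊log₂ n ⌋) ,
  (λ n → good-sound (d n) (k n) (ℓ n) ⌊log₂ n ⌋) ,
  probable
  where
  k : ℕ → ℕ
  k n = quotient (d∣n n)

  d-pos : ∀ n → 1 ≤ d n
  d-pos n = ℕₚ.≤-trans (s≤s z≤n) (2ℓ<d n)

  epsilon< : ∀ L k δ → 0ℚ ℚ.< δ → excess L k * ↧ₙ δ < k → ℚ.∣ epsilon L k ∣ ℚ.< δ
  epsilon< L k@(suc _) δ 0<δ = abs<-intro (epsilon L k) δ (excess L k) k (frac-num (excess L k) k) 0<δ

  ε→0 : TendsToZero (λ n → epsilon ⌊log₂ n ⌋ (k n))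
  ε→0 δ 0<δ =
    let q = ↧ₙ δ
        N₀ , large = block-growth d d∣n o[n/log] d-pos ((20 * q) * (4 * (20 * q)))
    in N₀ , λ n N₀≤n →
      let _ , 1≤L , LJ<k = large n N₀≤n
      in epsilon< ⌊log₂ n ⌋ (k n) δ 0<δ (excess-small q ⌊log₂ n ⌋ (k n) (s≤s z≤n) 1≤L LJ<k)

  probable : ProbTendsToOne d k (λ n → good (d n) (k n) (ℓ n) ⌊log₂ n ⌋)
  probable δ 0<δ =
    let q = ↧ₙ δ
        N₀ , large = block-growth d d∣n o[n/log] d-pos (q * q)
    in N₀ , λ n N₀≤n →
      let 1≤n , 1≤L , LJ<k = large n N₀≤n
          q²<k = ℕₚ.≤-<-trans (ℕₚ.m≤n*m (q * q) ⌊log₂ n ⌋ {{>-nonZero 1≤L}}) LJ<k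
      in good-probable (d n) (k n) (ℓ n) ⌊log₂ n ⌋ δ 0<δ (2ℓ<d n)
           -- A divisor of n is at most n, which the floor of log₂ n bounds only after adding one;
           -- hence `suc L` in `excess`.
           (ℕₚ.≤-trans (∣⇒≤ {{>-nonZero 1≤n}} (d∣n n)) (n≤2^1+⌊log₂n⌋ n))
           (ℕₚ.≤-trans (s≤s z≤n) q²<k) (ℕₚ.<⇒≤ q²<k)
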